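{- Let $M$ be a rank-$r$ matroid on $n$ elements. For $0\le h\le k\le r$ and every sequence $(s_h,s_{h+1},\ldots,s_k)$ of nonnegative integers, the number $F_{h,k}(s_h,s_{h+1},\ldots,s_k)$, and in particular the number $f_k(s)$ of flats of $M$ of rank $k$ and size $s$, is derivable from the catenary data of $M$ (that is, these numbers agree for any two rank-$r$ matroids on $n$ elements having the same catenary data). Also, if $f_k(s)=1$ and $F$ is the unique flat of $M$ of rank $k$ and size $s$, then both $\mathcal{G}(M|F)$ and $\mathcal{G}(M/F)$ can be derived from $\mathcal{G}(M)$ (that is, if $M_1$ is another matroid with $\mathcal{G}(M_1)=\mathcal{G}(M)$, then $M_1$ has a unique flat $F_1$ of rank $k$ and size $s$, and $\mathcal{G}(M_1|F_1)=\mathcal{G}(M|F)$ and $\mathcal{G}(M_1/F_1)=\mathcal{G}(M/F)$).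
   Context: For a rank-$r$ matroid $M$ on an $n$-element set $E$: $F_{h,k}(s_h,\ldots,s_k)$ is the number of chains $X_h\subset X_{h+1}\subset\cdots\subset X_k$ of flats of $M$ with $r(X_j)=j$ and $|X_j|=s_j$ for $h\le j\le k$; when $h=k$, $F_{k,k}(s)=f_k(s)$, the number of flats of rank $k$ and size $s$. An $(n,r)$-composition is an integer sequence $(a_0,\ldots,a_r)$ with $a_0\ge0$, $a_j>0$ for $1\le j\le r$, and sum $n$. A flag is a chain $X_0\subset X_1\subset\cdots\subset X_r=E$ of flats with $r(X_j)=j$; its composition is $(|X_0|,|X_1-X_0|,\ldots,|X_r-X_{r-1}|)$. $\nu(M;a_0,\ldots,a_r)$ is the number of flags with composition $(a_0,\ldots,a_r)$; the catenary data of $M$ is the vector of these numbers indexed by $(n,r)$-compositions. $\mathcal{G}(n,r)$ is the vector space over a field of characteristic zero with basis the formal symbols $[\underline{r}]$, one for each $0,1$-sequence of length $n$ with exactly $r$ ones. For a permutation (linear ordering) $\pi$ of $E$, the rank sequence $\underline{r}(\pi)=r_1\ldots r_n$ has $r_j=r(\{\pi(1),\ldots,\pi(j)\})-r(\{\pi(1),\ldots,\pi(j-1)\})$, and $\mathcal{G}(M)=\sum_\pi[\underline{r}(\pi)]\in\mathcal{G}(n,r)$ over all $n!$ permutations of $E$. Two matroids have the same $\mathcal{G}$-invariant if and only if they have the same catenary data. $M|F$ and $M/F$ denote restriction to and contraction by $F$. -}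

module Defs where

open import Algebra.Apartness.Bundles using (HeytingCommutativeRing; HeytingField)
open import Algebra.Bundles using (AbelianGroup; CommutativeRing)
import Algebra.Construct.Pointwise as Pointwise
open import Algebra.Module.Bundles using (LeftModule)
import Algebra.Definitions.RawMonoid as RawMonoidDefinitions
open import Data.Bool.Base using (if_then_else_)
import Data.Bool.Properties as Bool
open import Data.Fin.Base using (Fin; zero; suc; toℕ; fromℕ; inject₁)
import Data.Fin.Properties as Fin
open import Data.Fin.Subset
open import Data.Fin.Subset.Properties
open import Data.List.Base as List using (List; []; _∷_; allFin; cartesianProductWith; filter; length)
import Data.List.Relation.Unary.All as ListAll
open import Data.List.Relation.Unary.All.Properties using (all-filter)
open import Data.Nat.Base using (ℕ; zero; suc; _+_; _∸_; _≤_; _<_; z≤n; s≤s)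
open import Data.Nat.Properties
open import Data.Product.Base using (∃; _×_; _,_)
open import Data.Sum.Base using ([_,_]′)
open import Data.Vec.Base as Vec using (Vec; []; _∷_; count; lookup; sum; tail)
import Data.Vec.Properties as Vec
open import Data.Vec.Relation.Unary.All using (All; []; _∷_)
open import Function.Base using (_∘_)
open import Level using (Level)
open import Relation.Binary.PropositionalEquality
  using (_≡_; refl; sym; trans; cong; cong₂; subst; module ≡-Reasoning)
open import Relation.Nullary using (does; yes; no; ¬_; ¬?; _×-dec_; _→-dec_)
open import Relation.Unary using (Decidable)

private
  variable
    N n r k s m : ℕ

-- A rank-r matroid on an n-element set E, presented by its rank function.  The
-- ground set E is an arbitrary n-element subset of Fin N, so that restrictions
-- and contractions keep the names of the elements.  Values of `rank` at
-- subsets not contained in E are irrelevant.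
record Matroid (N n r : ℕ) : Set where
  field
    ground          : Subset N
    rank            : Subset N → ℕ
    ∣ground∣≡n      : ∣ ground ∣ ≡ n
    rank-ground     : rank ground ≡ r
    rank≤card       : ∀ {X} → X ⊆ ground → rank X ≤ ∣ X ∣
    rank-mono       : ∀ {X Y} → X ⊆ Y → Y ⊆ ground → rank X ≤ rank Y
    rank-submodular : ∀ {X Y} → X ⊆ ground → Y ⊆ ground →
                      rank (X ∪ Y) + rank (X ∩ Y) ≤ rank X + rank Y

open Matroid

private
  ∪-least : {X Y Z : Subset N} → X ⊆ Z → Y ⊆ Z → X ∪ Y ⊆ Z
  ∪-least {X = X} {Y = Y} X⊆Z Y⊆Z = [ X⊆Z , Y⊆Z ]′ ∘ x∈p∪q⁻ X Y

  ⁅⁆⊆ : {x : Fin N} {Z : Subset N} → x ∈ Z → ⁅ x ⁆ ⊆ Z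
  ⁅⁆⊆ {x = x} {Z} x∈Z y∈ = subst (_∈ Z) (sym (x∈⁅y⁆⇒x≡y x y∈)) x∈Z

  ∣q─p∣+∣p∣ : (p q : Subset N) → p ⊆ q → ∣ q ─ p ∣ + ∣ p ∣ ≡ ∣ q ∣
  ∣q─p∣+∣p∣ [] [] _ = refl
  ∣q─p∣+∣p∣ (outside ∷ p) (outside ∷ q) p⊆q = ∣q─p∣+∣p∣ p q (drop-∷-⊆ p⊆q)
  ∣q─p∣+∣p∣ (outside ∷ p) (inside ∷ q) p⊆q = cong suc (∣q─p∣+∣p∣ p q (drop-∷-⊆ p⊆q))
  ∣q─p∣+∣p∣ (inside ∷ p) (inside ∷ q) p⊆q =
    trans (+-suc ∣ q ─ p ∣ ∣ p ∣) (cong suc (∣q─p∣+∣p∣ p q (drop-∷-⊆ p⊆q)))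
  ∣q─p∣+∣p∣ (inside ∷ p) (outside ∷ q) p⊆q with p⊆q {zero} Vec.here
  ... | ()

  [q─p]∪p : (p q : Subset N) → p ⊆ q → (q ─ p) ∪ p ≡ q
  [q─p]∪p [] [] _ = refl
  [q─p]∪p (outside ∷ p) (outside ∷ q) p⊆q = cong (outside ∷_) ([q─p]∪p p q (drop-∷-⊆ p⊆q))
  [q─p]∪p (outside ∷ p) (inside ∷ q) p⊆q = cong (inside ∷_) ([q─p]∪p p q (drop-∷-⊆ p⊆q))
  [q─p]∪p (inside ∷ p) (inside ∷ q) p⊆q = cong (inside ∷_) ([q─p]∪p p q (drop-∷-⊆ p⊆q))
  [q─p]∪p (inside ∷ p) (outside ∷ q) p⊆q with p⊆q {zero} Vec.here
  ... | ()

  rank-∪≤ : (M : Matroid N n r) {X Y : Subset N} → X ⊆ ground M → Y ⊆ ground M →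
            rank M (X ∪ Y) ≤ rank M X + rank M Y
  rank-∪≤ M X⊆E Y⊆E = ≤-trans (m≤m+n _ _) (rank-submodular M X⊆E Y⊆E)

IsFlat : Matroid N n r → Subset N → Set
IsFlat M X = X ⊆ ground M ×
             (∀ x → x ∈ ground M → x ∉ X → rank M X < rank M (X ∪ ⁅ x ⁆))

isFlat? : (M : Matroid N n r) → Decidable (IsFlat M)
isFlat? M X = (X ⊆? ground M) ×-dec
  Fin.all? (λ x → (x ∈? ground M) →-dec (¬? (x ∈? X) →-dec (rank M X <? rank M (X ∪ ⁅ x ⁆))))

IsFlatOf : Matroid N n r → (k s : ℕ) → Subset N → Set
IsFlatOf M k s X = IsFlat M X × rank M X ≡ k × ∣ X ∣ ≡ s

isFlatOf? : (M : Matroid N n r) (k s : ℕ) → Decidable (IsFlatOf M k s)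
isFlatOf? M k s X = isFlat? M X ×-dec (rank M X ≟ k) ×-dec (∣ X ∣ ≟ s)

-- The flats of rank k and size s.
FlatOf : Matroid N n r → (k s : ℕ) → Set
FlatOf M k s = ∃ (IsFlatOf M k s)

restrict : (M : Matroid N n r) → FlatOf M k s → Matroid N s k
restrict M (F , (F⊆E , _) , rankF≡k , ∣F∣≡s) = record
  { ground          = F
  ; rank            = rank M
  ; ∣ground∣≡n      = ∣F∣≡s
  ; rank-ground     = rankF≡k
  ; rank≤card       = λ X⊆F → rank≤card M (F⊆E ∘ X⊆F)
  ; rank-mono       = λ X⊆Y Y⊆F → rank-mono M X⊆Y (F⊆E ∘ Y⊆F)
  ; rank-submodular = λ X⊆F Y⊆F → rank-submodular M (F⊆E ∘ X⊆F) (F⊆E ∘ Y⊆F)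
  }

contract : (M : Matroid N n r) → FlatOf M k s → Matroid N (n ∸ s) (r ∸ k)
contract {N} {n} {r} {k} {s} M (F , (F⊆E , _) , rankF≡k , ∣F∣≡s) = record
  { ground          = E ─ F
  ; rank            = λ X → ρ (X ∪ F) ∸ ρ F
  ; ∣ground∣≡n      = begin-equality
      ∣ E ─ F ∣                    ≡⟨ m+n∸n≡m ∣ E ─ F ∣ ∣ F ∣ ⟨
      (∣ E ─ F ∣ + ∣ F ∣) ∸ ∣ F ∣  ≡⟨ cong₂ _∸_ (trans (∣q─p∣+∣p∣ F E F⊆E) (∣ground∣≡n M)) ∣F∣≡s ⟩
      n ∸ s                        ∎
  ; rank-ground     = cong₂ _∸_ (trans (cong ρ ([q─p]∪p F E F⊆E)) (rank-ground M)) rankF≡k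
  ; rank≤card       = λ {X} X⊆ → begin
      ρ (X ∪ F) ∸ ρ F      ≤⟨ ∸-monoˡ-≤ (ρ F) (rank-∪≤ M (E─F⊆E ∘ X⊆) F⊆E) ⟩
      (ρ X + ρ F) ∸ ρ F    ≡⟨ m+n∸n≡m (ρ X) (ρ F) ⟩
      ρ X                  ≤⟨ rank≤card M (E─F⊆E ∘ X⊆) ⟩
      ∣ X ∣                ∎
  ; rank-mono       = λ {X} {Y} X⊆Y Y⊆ → ∸-monoˡ-≤ (ρ F)
      (rank-mono M (∪-least (p⊆p∪q F ∘ X⊆Y) (q⊆p∪q Y F)) (∪F⊆E Y⊆))
  ; rank-submodular = λ {X} {Y} X⊆ Y⊆ → +-cancelʳ-≤ (ρ F + ρ F) _ _ (begin
      ((ρ ((X ∪ Y) ∪ F) ∸ ρ F) + (ρ ((X ∩ Y) ∪ F) ∸ ρ F)) + (ρ F + ρ F)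
        ≡⟨ regroup (ρF≤ (∪-least X⊆ Y⊆)) (ρF≤ (X⊆ ∘ p∩q⊆p X Y)) ⟩
      ρ ((X ∪ Y) ∪ F) + ρ ((X ∩ Y) ∪ F)
        ≡⟨ cong₂ (λ A B → ρ A + ρ B) (∪-lemma X Y) (∪-distribʳ-∩ F X Y) ⟩
      ρ ((X ∪ F) ∪ (Y ∪ F)) + ρ ((X ∪ F) ∩ (Y ∪ F))
        ≤⟨ rank-submodular M (∪F⊆E X⊆) (∪F⊆E Y⊆) ⟩
      ρ (X ∪ F) + ρ (Y ∪ F)
        ≡⟨ regroup (ρF≤ X⊆) (ρF≤ Y⊆) ⟨
      ((ρ (X ∪ F) ∸ ρ F) + (ρ (Y ∪ F) ∸ ρ F)) + (ρ F + ρ F) ∎)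
  }
  where
  open ≤-Reasoning
  E = ground M
  ρ = rank M

  E─F⊆E : E ─ F ⊆ E
  E─F⊆E = p─q⊆p E F

  ∪F⊆E : {X : Subset N} → X ⊆ E ─ F → X ∪ F ⊆ E
  ∪F⊆E X⊆ = ∪-least (E─F⊆E ∘ X⊆) F⊆E

  ρF≤ : {X : Subset N} → X ⊆ E ─ F → ρ F ≤ ρ (X ∪ F)
  ρF≤ {X} X⊆ = rank-mono M (q⊆p∪q X F) (∪F⊆E X⊆)

  regroup : {a b c : ℕ} → c ≤ a → c ≤ b → ((a ∸ c) + (b ∸ c)) + (c + c) ≡ a + b
  regroup {a} {b} {c} c≤a c≤b = begin-equality
    ((a ∸ c) + (b ∸ c)) + (c + c)  ≡⟨ +-assoc (a ∸ c) (b ∸ c) (c + c) ⟩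
    (a ∸ c) + ((b ∸ c) + (c + c))  ≡⟨ cong ((a ∸ c) +_) (+-assoc (b ∸ c) c c) ⟨
    (a ∸ c) + (((b ∸ c) + c) + c)  ≡⟨ cong (λ d → (a ∸ c) + (d + c)) (m∸n+n≡m c≤b) ⟩
    (a ∸ c) + (b + c)              ≡⟨ cong ((a ∸ c) +_) (+-comm b c) ⟩
    (a ∸ c) + (c + b)              ≡⟨ +-assoc (a ∸ c) c b ⟨
    ((a ∸ c) + c) + b              ≡⟨ cong (_+ b) (m∸n+n≡m c≤a) ⟩
    a + b                          ∎

  ∪-lemma : (X Y : Subset N) → (X ∪ Y) ∪ F ≡ (X ∪ F) ∪ (Y ∪ F)
  ∪-lemma X Y = ⊆-antisym
    (∪-least (∪-least (p⊆p∪q (Y ∪ F) ∘ p⊆p∪q F) (q⊆p∪q (X ∪ F) (Y ∪ F) ∘ p⊆p∪q F))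
             (p⊆p∪q (Y ∪ F) ∘ q⊆p∪q X F))
    (∪-least (∪-least (p⊆p∪q F ∘ p⊆p∪q Y) (q⊆p∪q (X ∪ Y) F))
             (∪-least (p⊆p∪q F ∘ q⊆p∪q X Y) (q⊆p∪q (X ∪ Y) F)))

vectors : {A : Set} → List A → (m : ℕ) → List (Vec A m)
vectors xs zero    = [] ∷ []
vectors xs (suc m) = cartesianProductWith _∷_ xs (vectors xs m)

subsets : (N : ℕ) → List (Subset N)
subsets = vectors (inside ∷ outside ∷ [])

-- Xs = (X_h , … , X_{h+m}): flats X_j of rank j, strictly increasing.
IsChain : Matroid N n r → (h : ℕ) → Vec (Subset N) (suc m) → Set
IsChain M h Xs =
  (∀ i → IsFlat M (lookup Xs i) × rank M (lookup Xs i) ≡ h + toℕ i) ×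
  (∀ i → lookup Xs (inject₁ i) ⊂ lookup Xs (suc i))

isChain? : (M : Matroid N n r) (h : ℕ) → Decidable (IsChain {m = m} M h)
isChain? M h Xs =
  Fin.all? (λ i → isFlat? M (lookup Xs i) ×-dec (rank M (lookup Xs i) ≟ h + toℕ i)) ×-dec
  Fin.all? (λ i → lookup Xs (inject₁ i) ⊂? lookup Xs (suc i))

IsChainOf : Matroid N n r → (h : ℕ) → Vec ℕ (suc m) → Vec (Subset N) (suc m) → Set
IsChainOf M h s Xs = IsChain M h Xs × Vec.map ∣_∣ Xs ≡ s

isChainOf? : (M : Matroid N n r) (h : ℕ) (s : Vec ℕ (suc m)) → Decidable (IsChainOf M h s)
isChainOf? M h s Xs = isChain? M h Xs ×-dec Vec.≡-dec _≟_ (Vec.map ∣_∣ Xs) s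

-- f M k s is f_k(s).
f : Matroid N n r → (k s : ℕ) → ℕ
f M k s = length (filter (isFlatOf? M k s) (subsets _))

-- F M h k (s_h , … , s_k) is F_{h,k}(s_h,…,s_k), for h ≤ k.
F : Matroid N n r → (h k : ℕ) → Vec ℕ (suc (k ∸ h)) → ℕ
F M h k s = length (filter (isChainOf? M h s) (vectors (subsets _) (suc (k ∸ h))))

record Composition (n r : ℕ) : Set where
  field
    parts    : Vec ℕ (suc r)
    positive : All (0 <_) (tail parts)
    total    : sum parts ≡ n

open Composition public

-- X_0 ⊂ ⋯ ⊂ X_r = E
IsFlag : Matroid N n r → Vec (Subset N) (suc r) → Set
IsFlag {r = r} M Xs = IsChain M 0 Xs × lookup Xs (fromℕ r) ≡ ground M

differences : Subset N → Vec (Subset N) m → Vec ℕ m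
differences X []       = []
differences X (Y ∷ Ys) = ∣ Y ─ X ∣ ∷ differences Y Ys

-- (|X_0| , |X_1 - X_0| , … , |X_m - X_{m-1}|)
composition : Vec (Subset N) (suc m) → Vec ℕ (suc m)
composition (X ∷ Xs) = ∣ X ∣ ∷ differences X Xs

IsFlagOf : Matroid N n r → Composition n r → Vec (Subset N) (suc r) → Set
IsFlagOf M a Xs = IsFlag M Xs × composition Xs ≡ parts a

isFlagOf? : (M : Matroid N n r) (a : Composition n r) → Decidable (IsFlagOf M a)
isFlagOf? {r = r} M a Xs =
  (isChain? M 0 Xs ×-dec Vec.≡-dec Bool._≟_ (lookup Xs (fromℕ r)) (ground M)) ×-dec
  Vec.≡-dec _≟_ (composition Xs) (parts a)

ν : Matroid N n r → Composition n r → ℕ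
ν {r = r} M a = length (filter (isFlagOf? M a) (vectors (subsets _) (suc r)))

SameCatenaryData : {N₁ N₂ : ℕ} → Matroid N₁ n r → Matroid N₂ n r → Set
SameCatenaryData M₁ M₂ = ∀ a → ν M₁ a ≡ ν M₂ a

record Symbol (n r : ℕ) : Set where
  constructor symbol
  field
    entries : Vec ℕ n
    .zeroOne : All (_≤ 1) entries
    .ones    : count (_≟ 1) entries ≡ r

open Symbol public

-- The linear orderings (π(1) , … , π(n)) of the ground set.
IsOrdering : Matroid N n r → Vec (Fin N) n → Set
IsOrdering M π =
  (∀ i → lookup π i ∈ ground M) ×
  (∀ i j → lookup π i ≡ lookup π j → i ≡ j) ×
  (∀ x → x ∈ ground M → ∃ λ i → lookup π i ≡ x)

isOrdering? : (M : Matroid N n r) → Decidable (IsOrdering M)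
isOrdering? M π =
  Fin.all? (λ i → lookup π i ∈? ground M) ×-dec
  Fin.all? (λ i → Fin.all? (λ j → (lookup π i Fin.≟ lookup π j) →-dec (i Fin.≟ j))) ×-dec
  Fin.all? (λ x → (x ∈? ground M) →-dec Fin.any? (λ i → lookup π i Fin.≟ x))

orderings : (M : Matroid N n r) → List (∃ (IsOrdering M))
orderings {n = n} M = ListAll.toList (all-filter (isOrdering? M) (vectors (allFin _) n))

-- The rank increments along an ordering, starting after the elements of S.
rankIncrements : Matroid N n r → Subset N → Vec (Fin N) m → Vec ℕ m
rankIncrements M S []      = []
rankIncrements M S (x ∷ π) =
  (rank M (S ∪ ⁅ x ⁆) ∸ rank M S) ∷ rankIncrements M (S ∪ ⁅ x ⁆) π

private
  increments≤1 : (M : Matroid N n r) {S : Subset N} → S ⊆ ground M →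
                 (π : Vec (Fin N) m) → (∀ i → lookup π i ∈ ground M) →
                 All (_≤ 1) (rankIncrements M S π)
  increments≤1 M S⊆E []      π∈E = []
  increments≤1 M {S} S⊆E (x ∷ π) π∈E =
    (begin
      rank M (S ∪ ⁅ x ⁆) ∸ rank M S           ≤⟨ ∸-monoˡ-≤ (rank M S) (rank-∪≤ M S⊆E x⊆E) ⟩
      (rank M S + rank M ⁅ x ⁆) ∸ rank M S    ≡⟨ m+n∸m≡n (rank M S) _ ⟩
      rank M ⁅ x ⁆                            ≤⟨ rank≤card M x⊆E ⟩
      ∣ ⁅ x ⁆ ∣                               ≡⟨ ∣⁅x⁆∣≡1 x ⟩
      1                                       ∎)
    ∷ increments≤1 M (∪-least S⊆E x⊆E) π (π∈E ∘ suc)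
    where
    open ≤-Reasoning
    x⊆E : ⁅ x ⁆ ⊆ ground M
    x⊆E = ⁅⁆⊆ (π∈E zero)

  increments-sum : (M : Matroid N n r) {S : Subset N} → S ⊆ ground M →
                   (π : Vec (Fin N) m) → (∀ i → lookup π i ∈ ground M) →
                   (∀ x → x ∈ ground M → x ∉ S → ∃ λ i → lookup π i ≡ x) →
                   rank M S + sum (rankIncrements M S π) ≡ rank M (ground M)
  increments-sum M {S} S⊆E [] π∈E cover =
    trans (+-identityʳ _) (cong (rank M) (⊆-antisym S⊆E E⊆S))
    where
    E⊆S : ground M ⊆ S
    E⊆S {x} x∈E with x ∈? S
    ... | yes x∈S = x∈S
    ... | no x∉S with cover x x∈E x∉S
    ...   | () , _
  increments-sum {N = N} M {S} S⊆E (x ∷ π) π∈E cover = begin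
    rank M S + ((rank M S′ ∸ rank M S) + rest)   ≡⟨ +-assoc (rank M S) _ rest ⟨
    (rank M S + (rank M S′ ∸ rank M S)) + rest   ≡⟨ cong (_+ rest) (m+[n∸m]≡n (rank-mono M (p⊆p∪q ⁅ x ⁆) S′⊆E)) ⟩
    rank M S′ + rest                             ≡⟨ increments-sum M S′⊆E π (π∈E ∘ suc) cover′ ⟩
    rank M (ground M)                            ∎
    where
    open ≡-Reasoning
    S′ = S ∪ ⁅ x ⁆
    rest = sum (rankIncrements M S′ π)
    S′⊆E : S′ ⊆ ground M
    S′⊆E = ∪-least S⊆E (⁅⁆⊆ (π∈E zero))
    cover′ : ∀ y → y ∈ ground M → y ∉ S′ → ∃ λ i → lookup π i ≡ y
    cover′ y y∈E y∉S′ with cover y y∈E (y∉S′ ∘ p⊆p∪q ⁅ x ⁆)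
    ... | suc i , eq = i , eq
    ... | zero , refl with y∉S′ (q⊆p∪q S ⁅ x ⁆ (x∈⁅x⁆ x))
    ...   | ()

  count-ones : (v : Vec ℕ m) → All (_≤ 1) v → count (_≟ 1) v ≡ sum v
  count-ones []            []             = refl
  count-ones (zero ∷ v)    (_ ∷ v≤1)      = count-ones v v≤1
  count-ones (suc zero ∷ v) (_ ∷ v≤1)     = cong suc (count-ones v v≤1)
  count-ones (suc (suc _) ∷ v) (s≤s () ∷ _)

rankSequence : (M : Matroid N n r) → ∃ (IsOrdering M) → Symbol n r
rankSequence {N = N} M (π , π∈E , _ , covers) = symbol v v≤1 (begin
  count (_≟ 1) v       ≡⟨ count-ones v v≤1 ⟩
  sum v                ≡⟨ cong (_+ sum v) rank⊥≡0 ⟨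
  rank M ⊥ + sum v     ≡⟨ increments-sum M (⊆-min _) π π∈E (λ x x∈E _ → covers x x∈E) ⟩
  rank M (ground M)    ≡⟨ rank-ground M ⟩
  _                    ∎)
  where
  open ≡-Reasoning
  v = rankIncrements M ⊥ π
  v≤1 : All (_≤ 1) v
  v≤1 = increments≤1 M (⊆-min _) π π∈E
  rank⊥≡0 : rank M ⊥ ≡ 0
  rank⊥≡0 = n≤0⇒n≡0 (subst (rank M ⊥ ≤_) (∣⊥∣≡0 N) (rank≤card M (⊆-min _)))

module _ {c ℓ₁ ℓ₂ : Level} (K : HeytingField c ℓ₁ ℓ₂) where

  private
    ring : CommutativeRing c ℓ₁
    ring = HeytingCommutativeRing.commutativeRing (HeytingField.heytingCommutativeRing K)
    module R = CommutativeRing ring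

  open R using (_≈_; _*_; 0#; 1#; +-rawMonoid; +-abelianGroup)
  open RawMonoidDefinitions +-rawMonoid using () renaming (_×_ to _·_)

  CharacteristicZero : Set ℓ₁
  CharacteristicZero = ∀ m → ¬ (suc m · 1# ≈ 0#)

  -- The vector space with basis Symbol n r: since there are finitely many
  -- symbols, its elements are all the coefficient functions on them.
  𝒢 : (n r : ℕ) → LeftModule R.ring c ℓ₁
  𝒢 n r = record
    { Carrierᴹ     = Carrier
    ; _≈ᴹ_         = _≋_
    ; _+ᴹ_         = _∙_
    ; _*ₗ_         = λ x v t → x * v t
    ; 0ᴹ           = ε
    ; -ᴹ_          = _⁻¹
    ; isLeftModule = record
      { isLeftSemimodule = record
        { +ᴹ-isCommutativeMonoid = isCommutativeMonoid
        ; isPreleftSemimodule = record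
          { *ₗ-cong      = λ x≈y v≋w t → R.*-cong x≈y (v≋w t)
          ; *ₗ-zeroˡ     = λ v t → R.zeroˡ (v t)
          ; *ₗ-distribʳ  = λ v x y t → R.distribʳ (v t) x y
          ; *ₗ-identityˡ = λ v t → R.*-identityˡ (v t)
          ; *ₗ-assoc     = λ x y v t → R.*-assoc x y (v t)
          ; *ₗ-zeroʳ     = λ x t → R.zeroʳ x
          ; *ₗ-distribˡ  = λ x v w t → R.distribˡ x (v t) (w t)
          }
        }
      ; -ᴹ‿cong    = ⁻¹-cong
      ; -ᴹ‿inverse = inverse
      }
    }
    where open AbelianGroup (Pointwise.abelianGroup (Symbol n r) +-abelianGroup)
            using (Carrier; _∙_; ε; _⁻¹; isCommutativeMonoid; ⁻¹-cong; inverse)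
            renaming (_≈_ to _≋_)

  basis : Symbol n r → LeftModule.Carrierᴹ (𝒢 n r)
  basis t u = if does (Vec.≡-dec _≟_ (entries t) (entries u)) then 1# else 0#

  𝒢-invariant : Matroid N n r → LeftModule.Carrierᴹ (𝒢 n r)
  𝒢-invariant {n = n} {r = r} M =
    List.foldr _+ᴹ_ 0ᴹ (List.map (λ π → basis (rankSequence M π)) (orderings M))
    where open LeftModule (𝒢 n r) using (_+ᴹ_; 0ᴹ)

  Same𝒢 : {N₁ N₂ : ℕ} → Matroid N₁ n r → Matroid N₂ n r → Set ℓ₁
  Same𝒢 {n = n} {r = r} M₁ M₂ = 𝒢-invariant M₁ ≈ᴹ 𝒢-invariant M₂
    where open LeftModule (𝒢 n r) using (_≈ᴹ_)

-- Catenary data.  If X is a flat of rank j contained in a flat Y of larger rank,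
-- the sets Z ∖ X, for Z a flat of rank j + 1 between X and Y, partition Y ∖ X.  Hence the
-- number of chains of flats with prescribed ranks and sizes, multiplied by
-- |Y| − |X| for two consecutive terms with a gap in rank, is the sum of the
-- numbers of chains with one more term Z covering X, weighted by |Z| − |X|.
-- Starting from the closure of ∅ and ending with E, this reduces every such
-- number to numbers of flags.
--
-- 𝒢-invariant.  For g and k let C(u, v) be the sum, over the flats G of rank k
-- and size g, of the number of orderings of M|G with rank sequence u times the
-- number of orderings of M/G with rank sequence v.  An ordering of E whose
-- initial segment has rank sequence u of sum k is determined by the closure G of
-- that segment, an arrangement of the segment inside G, and an ordering of M/G
-- into which the remaining elements of G are inserted as loops.  The number of
-- orderings with rank sequence u v is therefore a combination of the C's with
-- g ≥ |u|, in which g = |u| contributes exactly C(u, v), so downward induction on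
-- g recovers C from 𝒢(M).  Everything is counted for partial orderings too: then
-- C([], []) is f_k(g), and when the flat F is unique, C(u, []) and C([], v) are the
-- coefficients of 𝒢(M|F) and 𝒢(M/F).

module Submission where

open import Defs
open import Algebra.Apartness.Bundles using (HeytingCommutativeRing; HeytingField)
open import Algebra.Bundles using (CommutativeRing)
import Algebra.Properties.Group as GroupProperties
import Algebra.Properties.Monoid.Mult as Mult
open import Data.Bool.Base using (if_then_else_; true; false)
open import Data.Empty using (⊥-elim)
open import Data.Fin.Base using (Fin; zero; suc; toℕ; fromℕ; inject₁)
import Data.Fin.Properties as Fin
open import Data.Fin.Subset
open import Data.Fin.Subset.Properties
open import Data.List.Base as List
  using (List; []; _∷_; [_]; _∷ʳ_; _++_; allFin; upTo; cartesianProductWith; filter; length; map)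
open import Data.List.Membership.Propositional using () renaming (_∈_ to _∈ˡ_)
open import Data.List.Membership.Propositional.Properties
  using (∈-allFin; ∈-upTo⁺; ∈-cartesianProductWith⁺; ∈-filter⁺)
open import Data.List.Properties using (length-++; ++-assoc; map-cong; map-++; map-tabulate)
open import Data.List.Relation.Unary.All as ListAll using ([]; _∷_)
open import Data.List.Relation.Unary.All.Properties using (all-filter)
open import Data.List.Relation.Unary.AllPairs using ([]; _∷_)
open import Data.List.Relation.Unary.Any using (here; there)
open import Data.List.Relation.Unary.Unique.Propositional using (Unique)
import Data.List.Relation.Unary.Unique.Propositional.Properties as Unique
open import Data.Nat.Base using (ℕ; zero; suc; _+_; _*_; _∸_; _≤_; _<_; z≤n; s≤s)
open import Data.Nat.ListAction using (sum)
open import Data.Nat.ListAction.Properties using (sum-++)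
open import Data.Nat.Properties
open import Data.Nat.Solver using (module +-*-Solver)
open import Data.Product.Base using (Σ; ∃; _×_; _,_; proj₁; proj₂)
open import Data.Sum.Base using (inj₁; inj₂; [_,_]′)
open import Data.Unit.Base using (tt) renaming (⊤ to Unit)
open import Data.Vec.Base as Vec using (Vec; []; _∷_; here; there; lookup; toList; fromList)
import Data.Vec.Properties as Vec
open import Data.Vec.Relation.Unary.All as VecAll using ([]; _∷_)
open import Function.Base using (_∘_; id; case_of_)
open import Relation.Binary.PropositionalEquality
  using (_≡_; _≢_; refl; sym; trans; cong; cong₂; subst; module ≡-Reasoning)
open import Relation.Nullary using (Dec; does; yes; no; ¬_; ¬?; _×-dec_)
open import Relation.Unary using (Decidable)

private
  variable
    A B : Set
    N n r m : ℕ

-- Finite sums and counting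

⟦_⟧ : {P : Set} → Dec P → ℕ
⟦ P? ⟧ = if does P? then 1 else 0

⟦⟧-cong : {P Q : Set} (P? : Dec P) (Q? : Dec Q) → (P → Q) → (Q → P) → ⟦ P? ⟧ ≡ ⟦ Q? ⟧
⟦⟧-cong (yes p) (yes q) P→Q Q→P = refl
⟦⟧-cong (yes p) (no ¬q) P→Q Q→P = ⊥-elim (¬q (P→Q p))
⟦⟧-cong (no ¬p) (yes q) P→Q Q→P = ⊥-elim (¬p (Q→P q))
⟦⟧-cong (no ¬p) (no ¬q) P→Q Q→P = refl

⟦⟧-true : {P : Set} (P? : Dec P) → P → ⟦ P? ⟧ ≡ 1
⟦⟧-true P? p = ⟦⟧-cong P? (yes p) id id

⟦⟧-×-dec : {P Q : Set} (P? : Dec P) (Q? : Dec Q) → ⟦ P? ×-dec Q? ⟧ ≡ ⟦ P? ⟧ * ⟦ Q? ⟧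
⟦⟧-×-dec (yes _) (yes _) = refl
⟦⟧-×-dec (yes _) (no _)  = refl
⟦⟧-×-dec (no _)  _       = refl

⟦⟧*-cong : {P Q : Set} (P? : Dec P) (Q? : Dec Q) → (P → Q) → (Q → P) →
           ∀ {a b} → (P → Q → a ≡ b) → ⟦ P? ⟧ * a ≡ ⟦ Q? ⟧ * b
⟦⟧*-cong (yes p) (yes q) P→Q Q→P a≡b = cong (_+ 0) (a≡b p q)
⟦⟧*-cong (yes p) (no ¬q) P→Q Q→P a≡b = ⊥-elim (¬q (P→Q p))
⟦⟧*-cong (no ¬p) (yes q) P→Q Q→P a≡b = ⊥-elim (¬p (Q→P q))
⟦⟧*-cong (no ¬p) (no ¬q) P→Q Q→P a≡b = refl

∑ : List A → (A → ℕ) → ℕ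
∑ xs g = sum (map g xs)

∑-cong : (xs : List A) {g h : A → ℕ} → (∀ x → g x ≡ h x) → ∑ xs g ≡ ∑ xs h
∑-cong xs g≗h = cong sum (map-cong g≗h xs)

∑-zero : (xs : List A) {g : A → ℕ} → (∀ x → g x ≡ 0) → ∑ xs g ≡ 0
∑-zero []       g≗0 = refl
∑-zero (x ∷ xs) g≗0 = cong₂ _+_ (g≗0 x) (∑-zero xs g≗0)

∑-distrib-+ : (xs : List A) (g h : A → ℕ) → ∑ xs (λ x → g x + h x) ≡ ∑ xs g + ∑ xs h
∑-distrib-+ []       g h = refl
∑-distrib-+ (x ∷ xs) g h = trans (cong (g x + h x +_) (∑-distrib-+ xs g h))
  (solve 4 (λ a b c d → a :+ b :+ (c :+ d) := a :+ c :+ (b :+ d)) refl (g x) (h x) (∑ xs g) (∑ xs h))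
  where open +-*-Solver using (solve; _:+_; _:*_; _:=_)

*-∑ : (c : ℕ) (xs : List A) (g : A → ℕ) → c * ∑ xs g ≡ ∑ xs (λ x → c * g x)
*-∑ c []       g = *-zeroʳ c
*-∑ c (x ∷ xs) g = trans (*-distribˡ-+ c (g x) (∑ xs g)) (cong (c * g x +_) (*-∑ c xs g))

∑-swap : (xs : List A) (ys : List B) (g : A → B → ℕ) →
         ∑ xs (λ x → ∑ ys (g x)) ≡ ∑ ys (λ y → ∑ xs (λ x → g x y))
∑-swap []       ys g = sym (∑-zero ys (λ _ → refl))
∑-swap (x ∷ xs) ys g = trans (cong (∑ ys (g x) +_) (∑-swap xs ys g))
                             (sym (∑-distrib-+ ys (g x) _))

∑-++ : (xs ys : List A) (g : A → ℕ) → ∑ (xs ++ ys) g ≡ ∑ xs g + ∑ ys g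
∑-++ xs ys g = trans (cong sum (map-++ g xs ys)) (sum-++ (map g xs) (map g ys))

∑-map : (h : A → B) (xs : List A) (g : B → ℕ) → ∑ (map h xs) g ≡ ∑ xs (g ∘ h)
∑-map h []       g = refl
∑-map h (x ∷ xs) g = cong (g (h x) +_) (∑-map h xs g)

∑-cartesianProductWith : {C : Set} (h : A → B → C) (xs : List A) (ys : List B) (g : C → ℕ) →
  ∑ (cartesianProductWith h xs ys) g ≡ ∑ xs (λ x → ∑ ys (λ y → g (h x y)))
∑-cartesianProductWith h []       ys g = refl
∑-cartesianProductWith h (x ∷ xs) ys g =
  trans (∑-++ (map (h x) ys) _ g) (cong₂ _+_ (∑-map (h x) ys g) (∑-cartesianProductWith h xs ys g))

-- The condition enters as a 0-1 factor rather than through `filter`, so that exchanging and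
-- splitting restricted sums is arithmetic on plain sums.
∑∣ : {P : A → Set} → Decidable P → List A → (A → ℕ) → ℕ
∑∣ P? xs g = ∑ xs (λ x → ⟦ P? x ⟧ * g x)

length-filter≡∑ : {P : A → Set} → (P? : Decidable P) (xs : List A) → length (filter P? xs) ≡ ∑ xs (λ x → ⟦ P? x ⟧)
length-filter≡∑ P? []       = refl
length-filter≡∑ P? (x ∷ xs) with does (P? x)
... | true  = cong suc (length-filter≡∑ P? xs)
... | false = length-filter≡∑ P? xs

∑-filter : {P : A → Set} → (P? : Decidable P) (xs : List A) (g : A → ℕ) → ∑ (filter P? xs) g ≡ ∑∣ P? xs g
∑-filter P? []       g = refl
∑-filter P? (x ∷ xs) g with does (P? x)
... | true  = cong₂ _+_ (sym (+-identityʳ (g x))) (∑-filter P? xs g)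
... | false = ∑-filter P? xs g

∑∣-cong : {P Q : A → Set} → (P? : Decidable P) (Q? : Decidable Q) (xs : List A) {g h : A → ℕ} →
          (∀ x → P x → Q x) → (∀ x → Q x → P x) → (∀ x → P x → Q x → g x ≡ h x) →
          ∑∣ P? xs g ≡ ∑∣ Q? xs h
∑∣-cong P? Q? xs P→Q Q→P g≗h =
  ∑-cong xs (λ x → ⟦⟧*-cong (P? x) (Q? x) (P→Q x) (Q→P x) (g≗h x))

∑∣-congʳ : {P : A → Set} → (P? : Decidable P) (xs : List A) {g h : A → ℕ} →
           (∀ x → P x → g x ≡ h x) → ∑∣ P? xs g ≡ ∑∣ P? xs h
∑∣-congʳ P? xs g≗h = ∑∣-cong P? P? xs (λ _ → id) (λ _ → id) (λ x p _ → g≗h x p)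

∑∣-zero : {P : A → Set} → (P? : Decidable P) (xs : List A) {g : A → ℕ} → (∀ x → P x → g x ≡ 0) → ∑∣ P? xs g ≡ 0
∑∣-zero P? xs g≗0 = trans (∑∣-congʳ P? xs g≗0) (∑-zero xs (λ x → *-zeroʳ ⟦ P? x ⟧))

∑∣-none : {P : A → Set} → (P? : Decidable P) (xs : List A) {g : A → ℕ} → (∀ x → ¬ P x) → ∑∣ P? xs g ≡ 0
∑∣-none P? xs ¬P = ∑∣-zero P? xs (λ x p → ⊥-elim (¬P x p))

*-∑∣ : {P : A → Set} → (c : ℕ) (P? : Decidable P) (xs : List A) (g : A → ℕ) →
       c * ∑∣ P? xs g ≡ ∑∣ P? xs (λ x → c * g x)
*-∑∣ c P? xs g = trans (*-∑ c xs _) (∑-cong xs λ x →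
  solve 3 (λ a b d → a :* (b :* d) := b :* (a :* d)) refl c ⟦ P? x ⟧ (g x))
  where open +-*-Solver using (solve; _:+_; _:*_; _:=_)

∑∣-* : {P : A → Set} → (c : ℕ) (P? : Decidable P) (xs : List A) (g : A → ℕ) →
       ∑∣ P? xs g * c ≡ ∑∣ P? xs (λ x → g x * c)
∑∣-* c P? xs g = trans (*-comm _ c) (trans (*-∑∣ c P? xs g)
  (∑∣-congʳ P? xs (λ x _ → *-comm c (g x))))

∑∣-+ : {P : A → Set} → (P? : Decidable P) (xs : List A) (g h : A → ℕ) →
       ∑∣ P? xs (λ x → g x + h x) ≡ ∑∣ P? xs g + ∑∣ P? xs h
∑∣-+ P? xs g h = trans (∑-cong xs (λ x → *-distribˡ-+ ⟦ P? x ⟧ (g x) (h x)))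
                       (∑-distrib-+ xs _ _)

∑∣-split : {P Q : A → Set} → (P? : Decidable P) (Q? : Decidable Q) (xs : List A) (g : A → ℕ) →
  ∑∣ P? xs g ≡ ∑∣ (λ x → P? x ×-dec Q? x) xs g + ∑∣ (λ x → P? x ×-dec ¬? (Q? x)) xs g
∑∣-split P? Q? xs g = trans (∑-cong xs pointwise) (∑-distrib-+ xs _ _)
  where
  pointwise : ∀ x → ⟦ P? x ⟧ * g x ≡
              ⟦ P? x ×-dec Q? x ⟧ * g x + ⟦ P? x ×-dec ¬? (Q? x) ⟧ * g x
  pointwise x with does (P? x) | does (Q? x)
  ... | true  | true  = sym (+-identityʳ _)
  ... | true  | false = refl
  ... | false | _     = refl

-- Double counting: `to` and `from` say that both pairs of conditions cut out the same pairs
-- `(x, y)`. The conditions themselves may change shape when the order of choice is reversed.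
∑∣-swap : {A B : Set} {P : A → Set} {Q : A → B → Set} {P′ : B → Set} {Q′ : B → A → Set}
  (P? : Decidable P) (Q? : ∀ x → Decidable (Q x)) (P′? : Decidable P′) (Q′? : ∀ y → Decidable (Q′ y))
  (xs : List A) (ys : List B) {g : A → B → ℕ} {h : B → A → ℕ} →
  (∀ x y → P x → Q x y → P′ y × Q′ y x) → (∀ x y → P′ y → Q′ y x → P x × Q x y) →
  (∀ x y → P x → Q x y → P′ y → Q′ y x → g x y ≡ h y x) →
  ∑∣ P? xs (λ x → ∑∣ (Q? x) ys (g x)) ≡ ∑∣ P′? ys (λ y → ∑∣ (Q′? y) xs (h y))
∑∣-swap P? Q? P′? Q′? xs ys {g} {h} to from g≗h = begin
  ∑∣ P? xs (λ x → ∑∣ (Q? x) ys (g x))                  ≡⟨ ∑-cong xs (λ x → *-∑ ⟦ P? x ⟧ ys _) ⟩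
  ∑ xs (λ x → ∑ ys (λ y → ⟦ P? x ⟧ * (⟦ Q? x y ⟧ * g x y)))
    ≡⟨ ∑-cong xs (λ x → ∑-cong ys (λ y → pointwise x y)) ⟩
  ∑ xs (λ x → ∑ ys (λ y → ⟦ P′? y ⟧ * (⟦ Q′? y x ⟧ * h y x))) ≡⟨ ∑-swap xs ys _ ⟩
  ∑ ys (λ y → ∑ xs (λ x → ⟦ P′? y ⟧ * (⟦ Q′? y x ⟧ * h y x)))
    ≡⟨ ∑-cong ys (λ y → *-∑ ⟦ P′? y ⟧ xs _) ⟨
  ∑∣ P′? ys (λ y → ∑∣ (Q′? y) xs (h y))                 ∎
  where
  open ≡-Reasoning
  merge : {P Q : Set} (P? : Dec P) (Q? : Dec Q) (a : ℕ) →
          ⟦ P? ⟧ * (⟦ Q? ⟧ * a) ≡ ⟦ P? ×-dec Q? ⟧ * a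
  merge P? Q? a = trans (sym (*-assoc ⟦ P? ⟧ ⟦ Q? ⟧ a)) (cong (_* a) (sym (⟦⟧-×-dec P? Q?)))
  pointwise : ∀ x y → ⟦ P? x ⟧ * (⟦ Q? x y ⟧ * g x y) ≡ ⟦ P′? y ⟧ * (⟦ Q′? y x ⟧ * h y x)
  pointwise x y = trans (merge (P? x) (Q? x y) (g x y))
    (trans (⟦⟧*-cong (P? x ×-dec Q? x y) (P′? y ×-dec Q′? y x)
              (λ (p , q) → to x y p q) (λ (p , q) → from x y p q)
              (λ (p , q) (p′ , q′) → g≗h x y p q p′ q′))
           (sym (merge (P′? y) (Q′? y x) (h y x))))

∑∣-single : {P : A → Set} → (P? : Decidable P) {xs : List A} → Unique xs → {a : A} → a ∈ˡ xs → P a →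
            (∀ x → P x → x ≡ a) → (g : A → ℕ) → ∑∣ P? xs g ≡ g a
∑∣-single {A = A} {P = P} P? {xs} (a∉xs ∷ _) {a} (here refl) Pa only g = begin
  ⟦ P? a ⟧ * g a + _    ≡⟨ cong₂ _+_ (cong (_* g a) (⟦⟧-true (P? a) Pa)) (rest _ a∉xs) ⟩
  g a + 0 + 0           ≡⟨ trans (+-identityʳ _) (+-identityʳ _) ⟩
  g a                   ∎
  where
  open ≡-Reasoning
  rest : (ys : List A) → ListAll.All (a ≢_) ys → ∑∣ P? ys g ≡ 0
  rest []       []             = refl
  rest (y ∷ ys) (a≢y ∷ a∉ys) = cong₂ _+_
    (⟦⟧*-cong (P? y) (no id) (λ p → a≢y (sym (only y p))) ⊥-elim {b = 0} (λ _ → ⊥-elim)) (rest ys a∉ys)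
∑∣-single P? {x ∷ xs} (x∉xs ∷ u) {a} (there a∈xs) Pa only g = cong₂ _+_
  (⟦⟧*-cong (P? x) (no id) (λ p → ListAll.lookup x∉xs a∈xs (only x p)) ⊥-elim {b = 0} (λ _ → ⊥-elim))
  (∑∣-single P? u a∈xs Pa only g)

∑-upTo : (m : ℕ) {a : ℕ} → a < m → (g : ℕ → ℕ) → ∑∣ (a ≟_) (upTo m) g ≡ g a
∑-upTo m a<m = ∑∣-single (_ ≟_) (Unique.upTo⁺ m) (∈-upTo⁺ a<m) refl (λ _ → sym)

-- All terms other than the one at `a` agree and cancel. This isolates the contribution of a single
-- flat size in the downward induction on sizes.
∑-upTo-injective : (m : ℕ) {a : ℕ} → a < m → (g h : ℕ → ℕ) → (∀ i → i ≢ a → g i ≡ h i) →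
                   ∑ (upTo m) g ≡ ∑ (upTo m) h → g a ≡ h a
∑-upTo-injective m {a} a<m g h agree eq = +-cancelʳ-≡ (rest g) (g a) (h a)
  (trans (sym (split g)) (trans eq (trans (split h) (cong (h a +_) (sym rest≡)))))
  where
  rest : (ℕ → ℕ) → ℕ
  rest g = ∑∣ (λ i → ¬? (a ≟ i)) (upTo m) g
  split : ∀ g → ∑ (upTo m) g ≡ g a + rest g
  split g = begin
    ∑ (upTo m) g ≡⟨ ∑-cong (upTo m) (λ i → pointwise i) ⟩
    ∑ (upTo m) (λ i → ⟦ a ≟ i ⟧ * g i + ⟦ ¬? (a ≟ i) ⟧ * g i) ≡⟨ ∑-distrib-+ (upTo m) _ _ ⟩
    ∑∣ (a ≟_) (upTo m) g + rest g ≡⟨ cong (_+ rest g) (∑-upTo m a<m g) ⟩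
    g a + rest g ∎
    where
    open ≡-Reasoning
    pointwise : ∀ i → g i ≡ ⟦ a ≟ i ⟧ * g i + ⟦ ¬? (a ≟ i) ⟧ * g i
    pointwise i with does (a ≟ i)
    ... | true  = sym (trans (+-identityʳ _) (+-identityʳ _))
    ... | false = sym (+-identityʳ _)
  rest≡ : rest g ≡ rest h
  rest≡ = ∑∣-congʳ (λ i → ¬? (a ≟ i)) (upTo m) (λ i a≢i → agree i (a≢i ∘ sym))

-- Subsets and their cardinalities

vectors-unique : {xs : List A} → Unique xs → ∀ m → Unique (vectors xs m)
vectors-unique u zero    = [] ∷ []
vectors-unique u (suc m) = Unique.cartesianProductWith⁺ _∷_ Vec.∷-injective u (vectors-unique u m)

∈-vectors : {xs : List A} → (∀ x → x ∈ˡ xs) → ∀ {m} (v : Vec A m) → v ∈ˡ vectors xs m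
∈-vectors all∈ []      = here refl
∈-vectors all∈ (x ∷ v) = ∈-cartesianProductWith⁺ _∷_ (all∈ x) (∈-vectors all∈ v)

subsets-unique : ∀ N → Unique (subsets N)
subsets-unique = vectors-unique (((λ ()) ∷ []) ∷ [] ∷ [])

∈-subsets : (X : Subset N) → X ∈ˡ subsets N
∈-subsets = ∈-vectors λ { inside → here refl ; outside → there (here refl) }

∑-subset-single : {P : Subset N → Set} → (P? : Decidable P) {X : Subset N} → P X → (∀ Y → P Y → Y ≡ X) →
                  (g : Subset N → ℕ) → ∑∣ P? (subsets N) g ≡ g X
∑-subset-single P? {X} = ∑∣-single P? (subsets-unique _) (∈-subsets X)

∑-fin-single : {P : Fin N → Set} → (P? : Decidable P) {x : Fin N} → P x → (∀ y → P y → y ≡ x) →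
               (g : Fin N → ℕ) → ∑∣ P? (allFin N) g ≡ g x
∑-fin-single P? {x} = ∑∣-single P? (Unique.allFin⁺ _) (∈-allFin x)

∑-∈≡∣∣ : (p : Subset N) → ∑∣ (_∈? p) (allFin N) (λ _ → 1) ≡ ∣ p ∣
∑-∈≡∣∣ []      = refl
∑-∈≡∣∣ {suc N} (s ∷ p) = trans (cong (⟦ zero ∈? (s ∷ p) ⟧ * 1 +_) tl) (hd s)
  where
  open ≡-Reasoning
  tl : ∑∣ (_∈? (s ∷ p)) (List.tabulate suc) (λ _ → 1) ≡ ∣ p ∣
  tl = begin
    ∑∣ (_∈? (s ∷ p)) (List.tabulate suc) (λ _ → 1)
      ≡⟨ cong (λ ys → ∑∣ (_∈? (s ∷ p)) ys (λ _ → 1)) (map-tabulate id suc) ⟨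
    ∑∣ (_∈? (s ∷ p)) (map suc (allFin N)) (λ _ → 1)
      ≡⟨ ∑-map suc (allFin N) _ ⟩
    ∑∣ (λ x → suc x ∈? (s ∷ p)) (allFin N) (λ _ → 1)
      ≡⟨ ∑∣-cong (λ x → suc x ∈? (s ∷ p)) (_∈? p) (allFin N) (λ _ → drop-there) (λ _ → there) (λ _ _ _ → refl) ⟩
    ∑∣ (_∈? p) (allFin N) (λ _ → 1)
      ≡⟨ ∑-∈≡∣∣ p ⟩
    ∣ p ∣ ∎
  hd : ∀ s → ⟦ zero ∈? (s ∷ p) ⟧ * 1 + ∣ p ∣ ≡ ∣ s ∷ p ∣
  hd inside  = refl
  hd outside = refl

∑-∖≡∣∣∸∣∣ : {p q : Subset N} → q ⊆ p →
            ∑∣ (λ x → (x ∈? p) ×-dec ¬? (x ∈? q)) (allFin N) (λ _ → 1) ≡ ∣ p ∣ ∸ ∣ q ∣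
∑-∖≡∣∣∸∣∣ {N} {p} {q} q⊆p = sym (begin
  ∣ p ∣ ∸ ∣ q ∣ ≡⟨ cong₂ _∸_ (∑-∈≡∣∣ p) (∑-∈≡∣∣ q) ⟨
  count (_∈? p) ∸ count (_∈? q)
    ≡⟨ cong₂ _∸_ (∑∣-split (_∈? p) (_∈? q) (allFin N) _)
         (∑∣-cong (_∈? q) (λ x → (x ∈? p) ×-dec (x ∈? q)) (allFin N) (λ _ x∈q → q⊆p x∈q , x∈q) (λ _ → proj₂) (λ _ _ _ → refl)) ⟩
  count (λ x → (x ∈? p) ×-dec (x ∈? q)) + _ ∸ count (λ x → (x ∈? p) ×-dec (x ∈? q))
    ≡⟨ m+n∸m≡n (count (λ x → (x ∈? p) ×-dec (x ∈? q))) _ ⟩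
  count (λ x → (x ∈? p) ×-dec ¬? (x ∈? q)) ∎)
  where
  open ≡-Reasoning
  count : {P : Fin N → Set} → Decidable P → ℕ
  count P? = ∑∣ P? (allFin N) (λ _ → 1)

∪-least : {X Y Z : Subset N} → X ⊆ Z → Y ⊆ Z → X ∪ Y ⊆ Z
∪-least {X = X} {Y} X⊆Z Y⊆Z = [ X⊆Z , Y⊆Z ]′ ∘ x∈p∪q⁻ X Y

⁅⁆⊆ : {x : Fin N} {Z : Subset N} → x ∈ Z → ⁅ x ⁆ ⊆ Z
⁅⁆⊆ {x = x} {Z} x∈Z y∈ = subst (_∈ Z) (sym (x∈⁅y⁆⇒x≡y x y∈)) x∈Z

∪⁅⁆⊆ : {x : Fin N} {X Z : Subset N} → X ⊆ Z → x ∈ Z → X ∪ ⁅ x ⁆ ⊆ Z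
∪⁅⁆⊆ X⊆Z x∈Z = ∪-least X⊆Z (⁅⁆⊆ x∈Z)

x∈X∪⁅x⁆ : (X : Subset N) (x : Fin N) → x ∈ X ∪ ⁅ x ⁆
x∈X∪⁅x⁆ X x = q⊆p∪q X ⁅ x ⁆ (x∈⁅x⁆ x)

X⊆X∪⁅x⁆ : (X : Subset N) (x : Fin N) → X ⊆ X ∪ ⁅ x ⁆
X⊆X∪⁅x⁆ X x = p⊆p∪q ⁅ x ⁆

∪-monoˡ : {X Y : Subset N} (Z : Subset N) → X ⊆ Y → X ∪ Z ⊆ Y ∪ Z
∪-monoˡ {Y = Y} Z X⊆Y = ∪-least (p⊆p∪q Z ∘ X⊆Y) (q⊆p∪q Y Z)

∣X∪⁅x⁆∣ : {X : Subset N} {x : Fin N} → x ∉ X → ∣ X ∪ ⁅ x ⁆ ∣ ≡ suc ∣ X ∣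
∣X∪⁅x⁆∣ {N} {X} {x} x∉X = begin
  ∣ X ∪ ⁅ x ⁆ ∣               ≡⟨ m∸n+n≡m (p⊆q⇒∣p∣≤∣q∣ (X⊆X∪⁅x⁆ X x)) ⟨
  ∣ X ∪ ⁅ x ⁆ ∣ ∸ ∣ X ∣ + ∣ X ∣ ≡⟨ cong (_+ ∣ X ∣) (∑-∖≡∣∣∸∣∣ (X⊆X∪⁅x⁆ X x)) ⟨
  ∑∣ new? (allFin N) (λ _ → 1) + ∣ X ∣
    ≡⟨ cong (_+ ∣ X ∣) (∑-fin-single new? (x∈X∪⁅x⁆ X x , x∉X) only (λ _ → 1)) ⟩
  suc ∣ X ∣                   ∎
  where
  open ≡-Reasoning
  new? = λ y → (y ∈? (X ∪ ⁅ x ⁆)) ×-dec ¬? (y ∈? X)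
  only : ∀ y → y ∈ X ∪ ⁅ x ⁆ × y ∉ X → y ≡ x
  only y (y∈ , y∉X) = [ ⊥-elim ∘ y∉X , x∈⁅y⁆⇒x≡y x ]′ (x∈p∪q⁻ X ⁅ x ⁆ y∈)

⊆∧∣∣≤⇒≡ : {X Y : Subset N} → X ⊆ Y → ∣ Y ∣ ≤ ∣ X ∣ → X ≡ Y
⊆∧∣∣≤⇒≡ {X = X} {Y} X⊆Y ∣Y∣≤∣X∣ = ⊆-antisym X⊆Y λ {x} x∈Y → case x ∈? X of λ where
  (yes x∈X) → x∈X
  (no x∉X)  → ⊥-elim (<⇒≱ (p⊂q⇒∣p∣<∣q∣ (X⊆Y , x , x∈Y , x∉X)) ∣Y∣≤∣X∣)

-- Ranks and flats

open Matroid

module _ {N n r : ℕ} (M : Matroid N n r) where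

  private
    E = ground M
    ρ = rank M

  -- Submodularity for `Y` and `X ∪ Z`: their union contains `Y ∪ Z`, their intersection contains
  -- `X`, and `ρ X` cancels against `ρ Y`.
  rank-absorb : {X Y Z : Subset N} → X ⊆ Y → Y ⊆ E → Z ⊆ E → ρ Y ≤ ρ X → ρ (Y ∪ Z) ≤ ρ (X ∪ Z)
  rank-absorb {X} {Y} {Z} X⊆Y Y⊆E Z⊆E ρY≤ρX = +-cancelʳ-≤ (ρ X) _ _ (begin
    ρ (Y ∪ Z) + ρ X
      ≤⟨ +-mono-≤ (rank-mono M (∪-least (p⊆p∪q (X ∪ Z)) (q⊆p∪q Y (X ∪ Z) ∘ q⊆p∪q X Z)) (∪-least Y⊆E X∪Z⊆E))
                  (rank-mono M (λ x∈X → x∈p∩q⁺ (X⊆Y x∈X , p⊆p∪q Z x∈X)) (Y⊆E ∘ p∩q⊆p Y (X ∪ Z))) ⟩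
    ρ (Y ∪ (X ∪ Z)) + ρ (Y ∩ (X ∪ Z)) ≤⟨ rank-submodular M Y⊆E X∪Z⊆E ⟩
    ρ Y + ρ (X ∪ Z)                   ≤⟨ +-monoˡ-≤ _ ρY≤ρX ⟩
    ρ X + ρ (X ∪ Z)                   ≡⟨ +-comm (ρ X) _ ⟩
    ρ (X ∪ Z) + ρ X                   ∎)
    where
    open ≤-Reasoning
    X∪Z⊆E : X ∪ Z ⊆ E
    X∪Z⊆E = ∪-least (Y⊆E ∘ X⊆Y) Z⊆E

  -- An element of `Y` outside the flat `Z` would raise the rank of `Z`; but `Y` adds no rank to
  -- `X`, hence none to the larger set `Z`.
  flat-⊇ : {X Y Z : Subset N} → IsFlat M Z → Y ⊆ E → X ⊆ Y → X ⊆ Z → ρ Y ≤ ρ X → Y ⊆ Z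
  flat-⊇ {X} {Y} {Z} (Z⊆E , flat) Y⊆E X⊆Y X⊆Z ρY≤ρX {y} y∈Y with y ∈? Z
  ... | yes y∈Z = y∈Z
  ... | no  y∉Z = ⊥-elim (<⇒≱ (flat y (Y⊆E y∈Y) y∉Z) (begin
    ρ (Z ∪ ⁅ y ⁆) ≤⟨ rank-mono M (∪⁅⁆⊆ (q⊆p∪q Y Z) (p⊆p∪q Z y∈Y)) (∪-least Y⊆E Z⊆E) ⟩
    ρ (Y ∪ Z)     ≤⟨ rank-absorb X⊆Y Y⊆E Z⊆E ρY≤ρX ⟩
    ρ (X ∪ Z)     ≤⟨ rank-mono M (∪-least X⊆Z id) Z⊆E ⟩
    ρ Z           ∎))
    where open ≤-Reasoning

  rank-∪⁅⁆≤ : {X : Subset N} {x : Fin N} → X ⊆ E → x ∈ E → ρ (X ∪ ⁅ x ⁆) ≤ suc (ρ X)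
  rank-∪⁅⁆≤ {X} {x} X⊆E x∈E = begin
    ρ (X ∪ ⁅ x ⁆)                     ≤⟨ m≤m+n _ _ ⟩
    ρ (X ∪ ⁅ x ⁆) + ρ (X ∩ ⁅ x ⁆)     ≤⟨ rank-submodular M X⊆E (⁅⁆⊆ x∈E) ⟩
    ρ X + ρ ⁅ x ⁆                     ≤⟨ +-monoʳ-≤ (ρ X) (≤-trans (rank≤card M (⁅⁆⊆ x∈E)) (≤-reflexive (∣⁅x⁆∣≡1 x))) ⟩
    ρ X + 1                           ≡⟨ +-comm (ρ X) 1 ⟩
    suc (ρ X)                         ∎
    where open ≤-Reasoning

  -- As long as some element outside the set leaves the rank unchanged, it is adjoined; when none is
  -- left, the set is a flat.
  closure : {X : Subset N} → X ⊆ E → ∃ λ Z → IsFlat M Z × ρ Z ≡ ρ X × X ⊆ Z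
  closure {X} X⊆E = grow (∣ E ∣ ∸ ∣ X ∣) X X⊆E ≤-refl
    where
    -- `d` bounds the number of elements of `E` still outside `X` and makes the recursion terminate.
    grow : ∀ d X → X ⊆ E → ∣ E ∣ ∸ ∣ X ∣ ≤ d → ∃ λ Z → IsFlat M Z × ρ Z ≡ ρ X × X ⊆ Z
    grow d X X⊆E gap with Fin.any? (λ x → (x ∈? E) ×-dec (¬? (x ∈? X) ×-dec (ρ (X ∪ ⁅ x ⁆) ≤? ρ X)))
    ... | no none = X , (X⊆E , λ x x∈E x∉X → ≰⇒> λ ρ≤ → none (x , x∈E , x∉X , ρ≤)) , refl , id
    ... | yes (x , x∈E , x∉X , ρ≤) = extend d gap
      where
      X′⊆E : X ∪ ⁅ x ⁆ ⊆ E
      X′⊆E = ∪⁅⁆⊆ X⊆E x∈E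
      extend : ∀ d → ∣ E ∣ ∸ ∣ X ∣ ≤ d → ∃ λ Z → IsFlat M Z × ρ Z ≡ ρ X × X ⊆ Z
      extend zero    gap = ⊥-elim (<⇒≱ (p⊂q⇒∣p∣<∣q∣ (X⊆E , x , x∈E , x∉X)) (m∸n≡0⇒m≤n (n≤0⇒n≡0 gap)))
      extend (suc d) gap =
        let Z , flat , ρZ≡ , X′⊆Z = grow d (X ∪ ⁅ x ⁆) X′⊆E (subst (λ c → ∣ E ∣ ∸ c ≤ d) (sym (∣X∪⁅x⁆∣ x∉X))
               (subst (_≤ d) (pred[m∸n]≡m∸[1+n] ∣ E ∣ ∣ X ∣) (pred-mono-≤ gap)))
        in Z , flat , trans ρZ≡ (≤-antisym ρ≤ (rank-mono M (X⊆X∪⁅x⁆ X x) X′⊆E)) , X′⊆Z ∘ X⊆X∪⁅x⁆ X x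

  -- Both flats are the closure of `X`, so `flat-⊇` applies in both directions.
  flat-unique : {X Y Z : Subset N} → IsFlat M Y → IsFlat M Z → X ⊆ Y → X ⊆ Z →
                ρ Y ≡ ρ X → ρ Z ≡ ρ X → Y ≡ Z
  flat-unique flatY flatZ X⊆Y X⊆Z ρY ρZ = ⊆-antisym
    (flat-⊇ flatZ (proj₁ flatY) X⊆Y X⊆Z (≤-reflexive ρY))
    (flat-⊇ flatY (proj₁ flatZ) X⊆Z X⊆Y (≤-reflexive ρZ))

  ground-flat : IsFlat M E
  ground-flat = id , λ x x∈E x∉E → ⊥-elim (x∉E x∈E)

  rank-⊥ : ρ ⊥ ≡ 0
  rank-⊥ = n≤0⇒n≡0 (≤-trans (rank≤card M (⊆-min E)) (≤-reflexive (∣⊥∣≡0 N)))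

  flat-rank≡r : {X : Subset N} → IsFlat M X → ρ X ≡ r → X ≡ E
  flat-rank≡r flat ρX≡r = ⊆-antisym (proj₁ flat)
    (flat-⊇ flat id (proj₁ flat) id (≤-reflexive (trans (rank-ground M) (sym ρX≡r))))

  flat-size≤n : {X : Subset N} → IsFlat M X → ∣ X ∣ ≤ n
  flat-size≤n flat = ≤-trans (p⊆q⇒∣p∣≤∣q∣ (proj₁ flat)) (≤-reflexive (∣ground∣≡n M))

  flat-size< : {X Y : Subset N} → IsFlat M X → IsFlat M Y → X ⊆ Y → ρ X < ρ Y → ∣ X ∣ < ∣ Y ∣
  flat-size< flatX flatY X⊆Y ρX<ρY = ≰⇒> λ ∣Y∣≤∣X∣ →
    <-irrefl (cong ρ (⊆∧∣∣≤⇒≡ X⊆Y ∣Y∣≤∣X∣)) ρX<ρY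

-- Turns sums over flats of a given rank into sums over possible sizes, so that only numbers that
-- can be compared between two matroids remain.
∑∣-fibres : {P : A → Set} (P? : Decidable P) (size : A → ℕ) (m : ℕ) → (∀ x → P x → size x < m) →
            (xs : List A) (g : A → ℕ) →
            ∑∣ P? xs g ≡ ∑ (upTo m) (λ i → ∑∣ (λ x → P? x ×-dec (size x ≟ i)) xs g)
∑∣-fibres P? size m bound xs g = begin
  ∑∣ P? xs g
    ≡⟨ ∑∣-congʳ P? xs (λ x p → sym (∑-upTo m (bound x p) (λ _ → g x))) ⟩
  ∑∣ P? xs (λ x → ∑∣ (size x ≟_) (upTo m) (λ _ → g x))
    ≡⟨ ∑-cong xs (λ x → *-∑ ⟦ P? x ⟧ (upTo m) _) ⟩
  ∑ xs (λ x → ∑ (upTo m) (λ i → ⟦ P? x ⟧ * (⟦ size x ≟ i ⟧ * g x)))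
    ≡⟨ ∑-swap xs (upTo m) _ ⟩
  ∑ (upTo m) (λ i → ∑ xs (λ x → ⟦ P? x ⟧ * (⟦ size x ≟ i ⟧ * g x)))
    ≡⟨ ∑-cong (upTo m) (λ i → ∑-cong xs (λ x →
         trans (sym (*-assoc ⟦ P? x ⟧ _ (g x))) (cong (_* g x) (sym (⟦⟧-×-dec (P? x) (size x ≟ i)))))) ⟩
  ∑ (upTo m) (λ i → ∑∣ (λ x → P? x ×-dec (size x ≟ i)) xs g) ∎
  where open ≡-Reasoning

-- Words of rank increments

-- Stated for a bare rank function, a set and a starting set, so that one notion serves `M`, the
-- restriction to `G` (with `G` in place of `E`) and the contraction by `G` (starting from `S = G`).
Step : (ρ : Subset N → ℕ) (E S : Subset N) → ℕ → Fin N → Set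
Step ρ E S b x = x ∈ E × x ∉ S × ρ (S ∪ ⁅ x ⁆) ∸ ρ S ≡ b

step? : (ρ : Subset N → ℕ) (E S : Subset N) (b : ℕ) → Decidable (Step ρ E S b)
step? ρ E S b x = (x ∈? E) ×-dec ¬? (x ∈? S) ×-dec (ρ (S ∪ ⁅ x ⁆) ∸ ρ S ≟ b)

-- The number of sequences of distinct elements of E ∖ S, as long as w but not
-- necessarily exhausting E ∖ S, along which ρ increases by the entries of w,
-- starting from S.
cnt : (ρ : Subset N → ℕ) (E S : Subset N) → List ℕ → ℕ
cnt ρ E S []      = 1
cnt ρ E S (b ∷ w) = ∑∣ (step? ρ E S b) (allFin _) (λ x → cnt ρ E (S ∪ ⁅ x ⁆) w)

cnt-long : (ρ : Subset N → ℕ) {E S : Subset N} → S ⊆ E → ∀ w → ∣ E ∣ < ∣ S ∣ + length w →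
           cnt ρ E S w ≡ 0
cnt-long ρ {E} {S} S⊆E [] E<S = ⊥-elim (<⇒≱ E<S (≤-trans (≤-reflexive (+-identityʳ _)) (p⊆q⇒∣p∣≤∣q∣ S⊆E)))
cnt-long ρ {E} {S} S⊆E (b ∷ w) E<S = ∑∣-zero (step? ρ E S b) (allFin _) λ x (x∈E , x∉S , _) →
  cnt-long ρ (∪⁅⁆⊆ S⊆E x∈E) w
    (subst (∣ E ∣ <_) (trans (+-suc ∣ S ∣ _) (cong (_+ length w) (sym (∣X∪⁅x⁆∣ x∉S)))) E<S)

-- j further loops are inserted into the words counted by φ.
withLoops : ℕ → (List ℕ → ℕ) → List ℕ → ℕ
withLoops j φ []      = φ []
withLoops j φ (b ∷ w) = withLoops j (φ ∘ (b ∷_)) w + ⟦ b ≟ 0 ⟧ * (j * withLoops (j ∸ 1) φ w)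

withLoops-cong : ∀ j {φ ψ : List ℕ → ℕ} → (∀ v → φ v ≡ ψ v) → ∀ w → withLoops j φ w ≡ withLoops j ψ w
withLoops-cong j φ≗ψ []      = φ≗ψ []
withLoops-cong j φ≗ψ (b ∷ w) = cong₂ (λ x y → x + ⟦ b ≟ 0 ⟧ * (j * y))
  (withLoops-cong j (φ≗ψ ∘ (b ∷_)) w) (withLoops-cong (j ∸ 1) φ≗ψ w)

withLoops-0 : (φ : List ℕ → ℕ) → ∀ w → withLoops 0 φ w ≡ φ w
withLoops-0 φ []      = refl
withLoops-0 φ (b ∷ w) = trans (cong (withLoops 0 (φ ∘ (b ∷_)) w +_) (*-zeroʳ ⟦ b ≟ 0 ⟧))
  (trans (+-identityʳ _) (withLoops-0 (φ ∘ (b ∷_)) w))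

withLoops-* : ∀ j c (φ : List ℕ → ℕ) → ∀ w → withLoops j (λ v → c * φ v) w ≡ c * withLoops j φ w
withLoops-* j c φ []      = refl
withLoops-* j c φ (b ∷ w) = trans
  (cong₂ (λ x y → x + ⟦ b ≟ 0 ⟧ * (j * y)) (withLoops-* j c (φ ∘ (b ∷_)) w) (withLoops-* (j ∸ 1) c φ w))
  (solve 5 (λ c x i j y → c :* x :+ i :* (j :* (c :* y)) := c :* (x :+ i :* (j :* y))) refl
     c (withLoops j (φ ∘ (b ∷_)) w) ⟦ b ≟ 0 ⟧ j (withLoops (j ∸ 1) φ w))
  where open +-*-Solver using (solve; _:+_; _:*_; _:=_)

withLoops-∑∣ : ∀ j {P : A → Set} (P? : Decidable P) (xs : List A) (φ : A → List ℕ → ℕ) → ∀ w →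
  withLoops j (λ v → ∑∣ P? xs (λ x → φ x v)) w ≡ ∑∣ P? xs (λ x → withLoops j (φ x) w)
withLoops-∑∣ j P? xs φ []      = refl
withLoops-∑∣ j P? xs φ (b ∷ w) = begin
  withLoops j (λ v → ∑∣ P? xs (λ x → φ x (b ∷ v))) w + i * (j * withLoops (j ∸ 1) (λ v → ∑∣ P? xs (λ x → φ x v)) w)
    ≡⟨ cong₂ (λ a c → a + i * (j * c)) (withLoops-∑∣ j P? xs (λ x → φ x ∘ (b ∷_)) w) (withLoops-∑∣ (j ∸ 1) P? xs φ w) ⟩
  kept + i * (j * ∑∣ P? xs (λ x → withLoops (j ∸ 1) (φ x) w))
    ≡⟨ cong (λ c → kept + i * c) (*-∑∣ j P? xs _) ⟩
  kept + i * ∑∣ P? xs (λ x → j * withLoops (j ∸ 1) (φ x) w)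
    ≡⟨ cong (kept +_) (*-∑∣ i P? xs _) ⟩
  kept + ∑∣ P? xs (λ x → i * (j * withLoops (j ∸ 1) (φ x) w))
    ≡⟨ ∑∣-+ P? xs _ _ ⟨
  ∑∣ P? xs (λ x → withLoops j (φ x) (b ∷ w)) ∎
  where
  open ≡-Reasoning
  i = ⟦ b ≟ 0 ⟧
  kept = ∑∣ P? xs (λ x → withLoops j (φ x ∘ (b ∷_)) w)

module _ {N n r : ℕ} (M : Matroid N n r) where

  private
    E = ground M
    ρ = rank M

  step-rank : {G S : Subset N} → G ⊆ E → S ⊆ G → ∀ {b x} → Step ρ G S b x → ρ (S ∪ ⁅ x ⁆) ≡ ρ S + b
  step-rank {G} {S} G⊆E S⊆G {b} {x} (x∈G , _ , inc≡b) = trans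
    (sym (m+[n∸m]≡n (rank-mono M (X⊆X∪⁅x⁆ S x) (G⊆E ∘ ∪⁅⁆⊆ S⊆G x∈G)))) (cong (ρ S +_) inc≡b)

  -- A sequence that exhausts `G` ends at rank `ρ G`, so its increments must add up to `ρ G` minus
  -- `ρ S`.
  cnt-full : {G S : Subset N} → G ⊆ E → S ⊆ G → ∀ w → ∣ S ∣ + length w ≡ ∣ G ∣ →
             ρ S + sum w ≢ ρ G → cnt ρ G S w ≡ 0
  cnt-full {G} {S} G⊆E S⊆G [] full wrong = ⊥-elim (wrong (trans (+-identityʳ _)
    (cong ρ (⊆∧∣∣≤⇒≡ S⊆G (≤-reflexive (trans (sym full) (+-identityʳ _)))))))
  cnt-full {G} {S} G⊆E S⊆G (b ∷ w) full wrong = ∑∣-zero (step? ρ G S b) (allFin N) λ x step@(x∈G , x∉S , _) →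
    cnt-full G⊆E (∪⁅⁆⊆ S⊆G x∈G) w
      (trans (cong (_+ length w) (∣X∪⁅x⁆∣ x∉S)) (trans (sym (+-suc ∣ S ∣ _)) full))
      (λ right → wrong (trans (sym (+-assoc (ρ S) b _))
        (trans (cong (_+ sum w) (sym (step-rank G⊆E S⊆G step))) right)))

  cnt-extend : {G S : Subset N} → G ⊆ E → S ⊆ G → ∀ w →
    (∣ G ∣ ∸ (∣ S ∣ + length w)) * cnt ρ G S w ≡ cnt ρ G S (w ∷ʳ 0) + cnt ρ G S (w ∷ʳ 1)
  cnt-extend {G} {S} G⊆E S⊆G [] = begin
    (∣ G ∣ ∸ (∣ S ∣ + 0)) * 1          ≡⟨ trans (*-identityʳ _) (cong (∣ G ∣ ∸_) (+-identityʳ ∣ S ∣)) ⟩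
    ∣ G ∣ ∸ ∣ S ∣                      ≡⟨ ∑-∖≡∣∣∸∣∣ S⊆G ⟨
    ∑∣ new? (allFin N) (λ _ → 1)       ≡⟨ ∑∣-split new? inc0? (allFin N) _ ⟩
    ∑∣ (λ x → new? x ×-dec inc0? x) (allFin N) (λ _ → 1) + ∑∣ (λ x → new? x ×-dec ¬? (inc0? x)) (allFin N) (λ _ → 1)
      ≡⟨ cong₂ _+_
          (∑∣-cong (λ x → new? x ×-dec inc0? x) (step? ρ G S 0) (allFin N)
            (λ x ((x∈G , x∉S) , eq) → x∈G , x∉S , eq) (λ x (x∈G , x∉S , eq) → (x∈G , x∉S) , eq) (λ _ _ _ → refl))
          (∑∣-cong (λ x → new? x ×-dec ¬? (inc0? x)) (step? ρ G S 1) (allFin N)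
            (λ x ((x∈G , x∉S) , inc≢0) → x∈G , x∉S , inc≡1 x∈G inc≢0)
            (λ x (x∈G , x∉S , eq) → (x∈G , x∉S) , λ eq′ → case trans (sym eq) eq′ of λ ()) (λ _ _ _ → refl)) ⟩
    cnt ρ G S [ 0 ] + cnt ρ G S [ 1 ] ∎
    where
    open ≡-Reasoning
    inc : Fin N → ℕ
    inc x = ρ (S ∪ ⁅ x ⁆) ∸ ρ S
    new?  = λ x → (x ∈? G) ×-dec ¬? (x ∈? S)
    inc0? = λ x → inc x ≟ 0
    inc≡1 : ∀ {x} → x ∈ G → inc x ≢ 0 → inc x ≡ 1
    inc≡1 {x} x∈G inc≢0 = ≤-antisym
      (≤-trans (∸-monoˡ-≤ (ρ S) (rank-∪⁅⁆≤ M (G⊆E ∘ S⊆G) (G⊆E x∈G))) (≤-reflexive (m+n∸n≡m 1 (ρ S))))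
      (n≢0⇒n>0 inc≢0)
  cnt-extend {G} {S} G⊆E S⊆G (b ∷ w) = begin
    (∣ G ∣ ∸ (∣ S ∣ + suc (length w))) * cnt ρ G S (b ∷ w)
      ≡⟨ *-∑∣ (∣ G ∣ ∸ (∣ S ∣ + suc (length w))) (step? ρ G S b) (allFin N) _ ⟩
    ∑∣ (step? ρ G S b) (allFin N) (λ x → (∣ G ∣ ∸ (∣ S ∣ + suc (length w))) * cnt ρ G (S ∪ ⁅ x ⁆) w)
      ≡⟨ ∑∣-congʳ (step? ρ G S b) (allFin N) (λ x (x∈G , x∉S , _) → trans
           (cong (λ c → (∣ G ∣ ∸ c) * cnt ρ G (S ∪ ⁅ x ⁆) w)
             (trans (+-suc ∣ S ∣ _) (cong (_+ length w) (sym (∣X∪⁅x⁆∣ x∉S)))))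
           (cnt-extend G⊆E (∪⁅⁆⊆ S⊆G x∈G) w)) ⟩
    ∑∣ (step? ρ G S b) (allFin N) (λ x → cnt ρ G (S ∪ ⁅ x ⁆) (w ∷ʳ 0) + cnt ρ G (S ∪ ⁅ x ⁆) (w ∷ʳ 1))
      ≡⟨ ∑∣-+ (step? ρ G S b) (allFin N) _ _ ⟩
    cnt ρ G S (b ∷ w ∷ʳ 0) + cnt ρ G S (b ∷ w ∷ʳ 1) ∎
    where open ≡-Reasoning

  -- Relative to `S`, the elements of `G` outside `S` are loops. A step outside `G` has the same
  -- increment over `S` as over `G` and keeps the number `j` of loops; a step inside `G` has
  -- increment 0 and uses up one of the `j` loops.
  cnt-absorb : {S G : Subset N} → S ⊆ G → G ⊆ E → ρ G ≡ ρ S → ∀ w →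
               cnt ρ E S w ≡ withLoops (∣ G ∣ ∸ ∣ S ∣) (cnt ρ E G) w
  cnt-absorb S⊆G G⊆E ρG≡ρS [] = refl
  cnt-absorb {S} {G} S⊆G G⊆E ρG≡ρS (b ∷ w) = begin
    cnt ρ E S (b ∷ w)
      ≡⟨ ∑∣-split (step? ρ E S b) (_∈? G) (allFin N) _ ⟩
    ∑∣ inner? (allFin N) (λ x → cnt ρ E (S ∪ ⁅ x ⁆) w) + ∑∣ outer? (allFin N) (λ x → cnt ρ E (S ∪ ⁅ x ⁆) w)
      ≡⟨ +-comm (∑∣ inner? (allFin N) (λ x → cnt ρ E (S ∪ ⁅ x ⁆) w)) _ ⟩
    ∑∣ outer? (allFin N) (λ x → cnt ρ E (S ∪ ⁅ x ⁆) w) + ∑∣ inner? (allFin N) (λ x → cnt ρ E (S ∪ ⁅ x ⁆) w)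
      ≡⟨ cong₂ _+_ outer inner ⟩
    withLoops j (cnt ρ E G) (b ∷ w) ∎
    where
    open ≡-Reasoning
    j = ∣ G ∣ ∸ ∣ S ∣
    inner? = λ x → step? ρ E S b x ×-dec (x ∈? G)
    outer? = λ x → step? ρ E S b x ×-dec ¬? (x ∈? G)

    rank≡ : ∀ {x} → x ∈ E → ρ (G ∪ ⁅ x ⁆) ≡ ρ (S ∪ ⁅ x ⁆)
    rank≡ {x} x∈E = ≤-antisym (rank-absorb M S⊆G G⊆E (⁅⁆⊆ x∈E) (≤-reflexive ρG≡ρS))
                        (rank-mono M (∪-monoˡ ⁅ x ⁆ S⊆G) (∪⁅⁆⊆ G⊆E x∈E))

    rank-inner : ∀ {x} → x ∈ G → ρ (S ∪ ⁅ x ⁆) ≡ ρ S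
    rank-inner {x} x∈G = ≤-antisym
      (≤-trans (rank-mono M (∪⁅⁆⊆ S⊆G x∈G) G⊆E) (≤-reflexive ρG≡ρS))
      (rank-mono M (X⊆X∪⁅x⁆ S x) (G⊆E ∘ ∪⁅⁆⊆ S⊆G x∈G))

    outer : ∑∣ outer? (allFin N) (λ x → cnt ρ E (S ∪ ⁅ x ⁆) w) ≡ withLoops j (cnt ρ E G ∘ (b ∷_)) w
    outer = trans
      (∑∣-cong outer? (step? ρ E G b) (allFin N)
        (λ x ((x∈E , x∉S , eq) , x∉G) → x∈E , x∉G , trans (cong₂ _∸_ (rank≡ x∈E) ρG≡ρS) eq)
        (λ x (x∈E , x∉G , eq) → (x∈E , x∉G ∘ S⊆G , trans (sym (cong₂ _∸_ (rank≡ x∈E) ρG≡ρS)) eq) , x∉G)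
        (λ x ((x∈E , x∉S , _) , x∉G) _ → trans
          (cnt-absorb (∪-monoˡ ⁅ x ⁆ S⊆G) (∪⁅⁆⊆ G⊆E x∈E) (rank≡ x∈E) w)
          (cong (λ j → withLoops j (cnt ρ E (G ∪ ⁅ x ⁆)) w) (cong₂ _∸_ (∣X∪⁅x⁆∣ x∉G) (∣X∪⁅x⁆∣ x∉S)))))
      (sym (withLoops-∑∣ j (step? ρ E G b) (allFin N) (λ x → cnt ρ E (G ∪ ⁅ x ⁆)) w))

    inner′ : (b≟0 : Dec (b ≡ 0)) → ∑∣ inner? (allFin N) (λ x → cnt ρ E (S ∪ ⁅ x ⁆) w) ≡
             ⟦ b≟0 ⟧ * (j * withLoops (j ∸ 1) (cnt ρ E G) w)
    inner′ (no b≢0) = ∑∣-none inner? (allFin N) λ x ((x∈E , x∉S , eq) , x∈G) → b≢0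
      (trans (sym eq) (trans (cong (_∸ ρ S) (rank-inner x∈G)) (n∸n≡0 (ρ S))))
    inner′ (yes refl) = begin
      ∑∣ inner? (allFin N) (λ x → cnt ρ E (S ∪ ⁅ x ⁆) w)
        ≡⟨ ∑∣-cong inner? new? (allFin N)
             (λ x ((_ , x∉S , _) , x∈G) → x∈G , x∉S)
             (λ x (x∈G , x∉S) → (G⊆E x∈G , x∉S , trans (cong (_∸ ρ S) (rank-inner x∈G)) (n∸n≡0 (ρ S))) , x∈G)
             (λ x _ (x∈G , x∉S) → trans
               (cnt-absorb (∪⁅⁆⊆ S⊆G x∈G) G⊆E (trans ρG≡ρS (sym (rank-inner x∈G))) w)
               (trans (cong (λ j → withLoops j (cnt ρ E G) w)
                 (trans (cong (∣ G ∣ ∸_) (trans (∣X∪⁅x⁆∣ x∉S) (+-comm 1 ∣ S ∣))) (sym (∸-+-assoc ∣ G ∣ ∣ S ∣ 1))))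
                 (sym (*-identityˡ _)))) ⟩
      ∑∣ new? (allFin N) (λ _ → 1 * rest) ≡⟨ ∑∣-* rest new? (allFin N) _ ⟨
      ∑∣ new? (allFin N) (λ _ → 1) * rest ≡⟨ cong (_* rest) (∑-∖≡∣∣∸∣∣ S⊆G) ⟩
      j * rest                            ≡⟨ +-identityʳ _ ⟨
      1 * (j * rest)                      ∎
      where
      new? = λ x → (x ∈? G) ×-dec ¬? (x ∈? S)
      rest = withLoops (j ∸ 1) (cnt ρ E G) w

    inner : ∑∣ inner? (allFin N) (λ x → cnt ρ E (S ∪ ⁅ x ⁆) w) ≡ ⟦ b ≟ 0 ⟧ * (j * withLoops (j ∸ 1) (cnt ρ E G) w)
    inner = inner′ (b ≟ 0)

  -- Split an ordering at the closure G of the elements of its initial segment.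
  cnt-++ : {S : Subset N} → S ⊆ E → ∀ {k} u v → ρ S + sum u ≡ k →
    cnt ρ E S (u ++ v) ≡
    ∑∣ (λ G → (isFlat? M G ×-dec (ρ G ≟ k)) ×-dec (S ⊆? G)) (subsets N)
       (λ G → cnt ρ G S u * withLoops (∣ G ∣ ∸ (∣ S ∣ + length u)) (cnt ρ E G) v)
  -- For the empty initial segment, the only flat of rank `k` above `S` is the closure `Z` of `S`,
  -- and the rest is `cnt-absorb`.
  cnt-++ {S} S⊆E {k} [] v ρS≡k = sym (trans
    (∑-subset-single (λ G → (isFlat? M G ×-dec (ρ G ≟ k)) ×-dec (S ⊆? G)) ((flatZ , trans ρZ≡ρS ρS≡k′) , S⊆Z)
      (λ { G ((flatG , ρG≡k) , S⊆G) → flat-unique M flatG flatZ S⊆G S⊆Z (trans ρG≡k (sym ρS≡k′)) ρZ≡ρS }) _)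
    (trans (+-identityʳ _) (trans
      (cong (λ c → withLoops (∣ Z ∣ ∸ c) (cnt ρ E Z) v) (+-identityʳ ∣ S ∣))
      (sym (cnt-absorb S⊆Z (proj₁ flatZ) ρZ≡ρS v)))))
    where
    cl = closure M S⊆E
    Z = proj₁ cl
    flatZ = proj₁ (proj₂ cl)
    ρZ≡ρS = proj₁ (proj₂ (proj₂ cl))
    S⊆Z : S ⊆ Z
    S⊆Z = proj₂ (proj₂ (proj₂ cl))
    ρS≡k′ : ρ S ≡ k
    ρS≡k′ = trans (sym (+-identityʳ _)) ρS≡k
  cnt-++ {S} S⊆E {k} (b ∷ u) v ρS≡k = begin
    cnt ρ E S (b ∷ u ++ v)
      ≡⟨ ∑∣-congʳ (step? ρ E S b) (allFin N) (λ x step@(x∈E , x∉S , _) → cnt-++ (∪⁅⁆⊆ S⊆E x∈E) u v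
           (trans (cong (_+ sum u) (step-rank id S⊆E step)) (trans (+-assoc (ρ S) b _) ρS≡k))) ⟩
    ∑∣ (step? ρ E S b) (allFin N) (λ x → ∑∣ (above? (S ∪ ⁅ x ⁆)) (subsets N)
      (λ G → cnt ρ G (S ∪ ⁅ x ⁆) u * withLoops (∣ G ∣ ∸ (∣ S ∪ ⁅ x ⁆ ∣ + length u)) (cnt ρ E G) v))
      -- Choosing `x` in `E` and then a flat `G` above `S ∪ ⁅ x ⁆` amounts to choosing `G` above `S`
      -- and then `x` inside `G`.
      ≡⟨ ∑∣-swap (step? ρ E S b) (λ x → above? (S ∪ ⁅ x ⁆)) (above? S) (λ G → step? ρ G S b) (allFin N) (subsets N)
           (λ x G (x∈E , x∉S , eq) (flat , S′⊆G) →
             (flat , S′⊆G ∘ X⊆X∪⁅x⁆ S x) , (S′⊆G (x∈X∪⁅x⁆ S x) , x∉S , eq))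
           (λ x G (flat , S⊆G) (x∈G , x∉S , eq) →
             (proj₁ (proj₁ flat) x∈G , x∉S , eq) , (flat , ∪⁅⁆⊆ S⊆G x∈G))
           (λ x G (_ , x∉S , _) _ _ _ → cong (λ c → cnt ρ G (S ∪ ⁅ x ⁆) u * withLoops (∣ G ∣ ∸ c) (cnt ρ E G) v)
             (trans (cong (_+ length u) (∣X∪⁅x⁆∣ x∉S)) (sym (+-suc ∣ S ∣ _)))) ⟩
    ∑∣ (above? S) (subsets N) (λ G → ∑∣ (step? ρ G S b) (allFin N) (λ x →
      cnt ρ G (S ∪ ⁅ x ⁆) u * withLoops (∣ G ∣ ∸ (∣ S ∣ + suc (length u))) (cnt ρ E G) v))
      ≡⟨ ∑-cong (subsets N) (λ G → cong (⟦ above? S G ⟧ *_) (∑∣-* _ (step? ρ G S b) (allFin N) _)) ⟨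
    ∑∣ (above? S) (subsets N)
      (λ G → cnt ρ G S (b ∷ u) * withLoops (∣ G ∣ ∸ (∣ S ∣ + suc (length u))) (cnt ρ E G) v) ∎
    where
    open ≡-Reasoning
    above? = λ S G → (isFlat? M G ×-dec (ρ G ≟ k)) ×-dec (S ⊆? G)

-- One-letter extensions of words

length-∷ʳ : (w : List A) (a : A) → length (w ∷ʳ a) ≡ suc (length w)
length-∷ʳ w a = trans (length-++ w) (+-comm (length w) 1)

-- The property of counting words along partial orderings of an n-element set:
-- such an ordering w extends in n ∸ length w ways, each with increment 0 or 1.
Extensive : ℕ → (List ℕ → ℕ) → Set
Extensive n φ = (∀ w → (n ∸ length w) * φ w ≡ φ (w ∷ʳ 0) + φ (w ∷ʳ 1)) ×
                (∀ w → n < length w → φ w ≡ 0)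

-- The value at a word shorter than `n` is determined by the values at its two extensions, because
-- the factor `n ∸ length w` is positive and cancels; beyond length `n` both functions vanish. So
-- agreement on words of length `n` suffices.
extensive-≗ : {φ ψ : List ℕ → ℕ} → Extensive n φ → Extensive n ψ →
              (∀ w → length w ≡ n → φ w ≡ ψ w) → ∀ w → φ w ≡ ψ w
extensive-≗ {n} {φ} {ψ} (φ-extend , φ-long) (ψ-extend , ψ-long) full w with ≤-<-connex (length w) n
... | inj₂ long  = trans (φ-long w long) (sym (ψ-long w long))
... | inj₁ short = shorter (n ∸ length w) w (m+[n∸m]≡n short)
  where
  shorter : ∀ d w → length w + d ≡ n → φ w ≡ ψ w
  shorter zero    w eq = full w (trans (sym (+-identityʳ _)) eq)
  shorter (suc d) w eq = *-cancelˡ-≡ (φ w) (ψ w) (suc d) (begin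
    suc d * φ w            ≡⟨ cong (_* φ w) gap ⟨
    (n ∸ length w) * φ w   ≡⟨ φ-extend w ⟩
    φ (w ∷ʳ 0) + φ (w ∷ʳ 1) ≡⟨ cong₂ _+_ (shorter d (w ∷ʳ 0) (eq′ 0)) (shorter d (w ∷ʳ 1) (eq′ 1)) ⟩
    ψ (w ∷ʳ 0) + ψ (w ∷ʳ 1) ≡⟨ ψ-extend w ⟨
    (n ∸ length w) * ψ w   ≡⟨ cong (_* ψ w) gap ⟩
    suc d * ψ w            ∎)
    where
    open ≡-Reasoning
    gap : n ∸ length w ≡ suc d
    gap = trans (cong (_∸ length w) (sym eq)) (m+n∸m≡n (length w) (suc d))
    eq′ : ∀ b → length (w ∷ʳ b) + d ≡ n
    eq′ b = trans (cong (_+ d) (length-∷ʳ w b)) (trans (sym (+-suc (length w) d)) eq)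

-- Counts split at the flats of one rank and size

module _ {N n r : ℕ} (M : Matroid N n r) where

  private
    E = ground M
    ρ = rank M

  cnt-extensive : {G : Subset N} → G ⊆ E → Extensive (∣ G ∣) (cnt ρ G ⊥)
  cnt-extensive {G} G⊆E =
    (λ w → trans (cong (λ c → (∣ G ∣ ∸ (c + length w)) * cnt ρ G ⊥ w) (sym (∣⊥∣≡0 N)))
                 (cnt-extend M G⊆E (⊆-min G) w)) ,
    (λ w long → cnt-long ρ (⊆-min G) w (subst (λ c → ∣ G ∣ < c + length w) (sym (∣⊥∣≡0 N)) long))

  -- The number `C(u, v)` for flats of rank `k` and size `g`.
  splitCnt : (k g : ℕ) (u v : List ℕ) → ℕ
  splitCnt k g u v = ∑∣ (isFlatOf? M k g) (subsets N) (λ G → cnt ρ G ⊥ u * cnt ρ E G v)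

  -- For fixed `v` this is a linear combination of the counts `cnt ρ G ⊥`, all of them extensive
  -- with the same bound because every `G` involved has size `g`.
  splitCnt-extensive : ∀ k g v → Extensive g (λ u → splitCnt k g u v)
  splitCnt-extensive k g v = extend , long
    where
    open ≡-Reasoning
    extend : ∀ u → (g ∸ length u) * splitCnt k g u v ≡ splitCnt k g (u ∷ʳ 0) v + splitCnt k g (u ∷ʳ 1) v
    extend u = begin
      (g ∸ length u) * splitCnt k g u v ≡⟨ *-∑∣ (g ∸ length u) (isFlatOf? M k g) (subsets N) _ ⟩
      ∑∣ (isFlatOf? M k g) (subsets N) (λ G → (g ∸ length u) * (cnt ρ G ⊥ u * cnt ρ E G v))
        ≡⟨ ∑∣-congʳ (isFlatOf? M k g) (subsets N) (λ { G ((G⊆E , _) , _ , refl) → trans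
             (sym (*-assoc (g ∸ length u) (cnt ρ G ⊥ u) _))
             (trans (cong (_* cnt ρ E G v) (proj₁ (cnt-extensive G⊆E) u))
                    (*-distribʳ-+ (cnt ρ E G v) (cnt ρ G ⊥ (u ∷ʳ 0)) _)) }) ⟩
      ∑∣ (isFlatOf? M k g) (subsets N) (λ G → cnt ρ G ⊥ (u ∷ʳ 0) * cnt ρ E G v + cnt ρ G ⊥ (u ∷ʳ 1) * cnt ρ E G v)
        ≡⟨ ∑∣-+ (isFlatOf? M k g) (subsets N) _ _ ⟩
      splitCnt k g (u ∷ʳ 0) v + splitCnt k g (u ∷ʳ 1) v ∎
    long : ∀ u → g < length u → splitCnt k g u v ≡ 0
    long u g<u = ∑∣-zero (isFlatOf? M k g) (subsets N) λ { G ((G⊆E , _) , _ , refl) →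
      cong (_* cnt ρ E G v) (proj₂ (cnt-extensive G⊆E) u g<u) }

  splitCnt-full : ∀ {k g} u v → length u ≡ g → sum u ≢ k → splitCnt k g u v ≡ 0
  splitCnt-full {k} {g} u v full sum≢k = ∑∣-zero (isFlatOf? M k g) (subsets N)
    λ { G ((G⊆E , _) , refl , refl) → cong (_* cnt ρ E G v) (cnt-full M G⊆E (⊆-min G) u
          (trans (cong (_+ length u) (∣⊥∣≡0 N)) full)
          (sum≢k ∘ trans (cong (_+ sum u) (sym (rank-⊥ M))))) }

  splitCnt-big : ∀ k {g} u v → n < g → splitCnt k g u v ≡ 0
  splitCnt-big k u v n<g = ∑∣-none (isFlatOf? M k _) (subsets N) λ { G (flat , _ , refl) →
    <⇒≱ n<g (flat-size≤n M flat) }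

  -- The flats in `cnt-++` are sorted by size. For size `g` the number of leftover loops,
  -- `g ∸ length u`, is the same for all flats, so linearity of `withLoops` lets the sum over flats
  -- move inside.
  cnt≡∑splitCnt : ∀ u v → cnt ρ E ⊥ (u ++ v) ≡
    ∑ (upTo (suc n)) (λ g → withLoops (g ∸ length u) (splitCnt (sum u) g u) v)
  cnt≡∑splitCnt u v = begin
    cnt ρ E ⊥ (u ++ v)
      ≡⟨ cnt-++ M (⊆-min E) u v (cong (_+ sum u) (rank-⊥ M)) ⟩
    ∑∣ (λ G → rank? G ×-dec (⊥ ⊆? G)) (subsets N)
      (λ G → cnt ρ G ⊥ u * withLoops (∣ G ∣ ∸ (∣ ⊥ {N} ∣ + length u)) (cnt ρ E G) v)
      ≡⟨ ∑∣-cong (λ G → rank? G ×-dec (⊥ ⊆? G)) rank? (subsets N) (λ _ → proj₁) (λ G flat → flat , ⊆-min G)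
           (λ G _ _ → cong (λ c → cnt ρ G ⊥ u * withLoops (∣ G ∣ ∸ (c + length u)) (cnt ρ E G) v) (∣⊥∣≡0 N)) ⟩
    ∑∣ rank? (subsets N) (λ G → cnt ρ G ⊥ u * withLoops (∣ G ∣ ∸ length u) (cnt ρ E G) v)
      ≡⟨ ∑∣-fibres rank? ∣_∣ (suc n) (λ G (flat , _) → s≤s (flat-size≤n M flat)) (subsets N) _ ⟩
    ∑ (upTo (suc n)) (λ g → ∑∣ (λ G → rank? G ×-dec (∣ G ∣ ≟ g)) (subsets N)
      (λ G → cnt ρ G ⊥ u * withLoops (∣ G ∣ ∸ length u) (cnt ρ E G) v))
      ≡⟨ ∑-cong (upTo (suc n)) (λ g → trans
           (∑∣-cong (λ G → rank? G ×-dec (∣ G ∣ ≟ g)) (isFlatOf? M (sum u) g) (subsets N)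
             (λ G ((flat , ρG) , ∣G∣) → flat , ρG , ∣G∣) (λ G (flat , ρG , ∣G∣) → (flat , ρG) , ∣G∣)
             (λ { G (_ , refl) _ → sym (withLoops-* (g ∸ length u) (cnt ρ G ⊥ u) (cnt ρ E G) v) }))
           (sym (withLoops-∑∣ (g ∸ length u) (isFlatOf? M (sum u) g) (subsets N) (λ G v → cnt ρ G ⊥ u * cnt ρ E G v) v))) ⟩
    ∑ (upTo (suc n)) (λ g → withLoops (g ∸ length u) (splitCnt (sum u) g u) v) ∎
    where
    open ≡-Reasoning
    rank? = λ G → isFlat? M G ×-dec (ρ G ≟ sum u)

  splitCnt-[] : ∀ k g → splitCnt k g [] [] ≡ f M k g
  splitCnt-[] k g = trans (∑-cong (subsets N) (λ G → *-identityʳ _)) (sym (length-filter≡∑ (isFlatOf? M k g) (subsets N)))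

module _ {N N₁ n r : ℕ} (M : Matroid N n r) (M₁ : Matroid N₁ n r) where

  -- For u of length g and sum k, the identity cnt≡∑splitCnt involves no flats
  -- smaller than g, and it involves those of size g only through splitCnt k g u v.
  splitCnt-≗ : (∀ w → cnt (rank M) (ground M) ⊥ w ≡ cnt (rank M₁) (ground M₁) ⊥ w) →
               ∀ k g u v → splitCnt M k g u v ≡ splitCnt M₁ k g u v
  splitCnt-≗ same k g u v with ≤-<-connex g n
  ... | inj₂ n<g = trans (splitCnt-big M k u v n<g) (sym (splitCnt-big M₁ k u v n<g))
  ... | inj₁ g≤n = descend (n ∸ g) g g≤n ≤-refl u v
    where
    -- Induction on the bound `d` for `n ∸ g`, from large sizes to small ones; extensivity in `u`
    -- leaves only words of length `g` to compare.
    descend : ∀ d g → g ≤ n → n ∸ g ≤ d → ∀ u v → splitCnt M k g u v ≡ splitCnt M₁ k g u v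
    descend d g g≤n bound u v = extensive-≗ (splitCnt-extensive M k g v) (splitCnt-extensive M₁ k g v) full u
      where
      bigger : ∀ g′ → g < g′ → ∀ u v → splitCnt M k g′ u v ≡ splitCnt M₁ k g′ u v
      bigger g′ g<g′ u v with ≤-<-connex g′ n
      ... | inj₂ n<g′ = trans (splitCnt-big M k u v n<g′) (sym (splitCnt-big M₁ k u v n<g′))
      ... | inj₁ g′≤n = step d bound
        where
        step : ∀ d → n ∸ g ≤ d → splitCnt M k g′ u v ≡ splitCnt M₁ k g′ u v
        step zero    bound = ⊥-elim (<⇒≱ (≤-trans g<g′ g′≤n) (m∸n≡0⇒m≤n (n≤0⇒n≡0 bound)))
        step (suc d) bound = descend d g′ g′≤n
          (≤-pred (≤-trans (∸-monoʳ-< g<g′ g′≤n) bound)) u v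

      full : ∀ u → length u ≡ g → splitCnt M k g u v ≡ splitCnt M₁ k g u v
      full u refl with sum u ≟ k
      ... | no sum≢k = trans (splitCnt-full M u v refl sum≢k) (sym (splitCnt-full M₁ u v refl sum≢k))
      ... | yes refl = begin
        splitCnt M k g u v                        ≡⟨ withLoops-0 (splitCnt M k g u) v ⟨
        withLoops 0 (splitCnt M k g u) v          ≡⟨ cong (λ j → withLoops j (splitCnt M k g u) v) (n∸n≡0 g) ⟨
        withLoops (g ∸ g) (splitCnt M k g u) v
          ≡⟨ ∑-upTo-injective (suc n) (s≤s g≤n)
               (λ g′ → withLoops (g′ ∸ g) (splitCnt M k g′ u) v)
               (λ g′ → withLoops (g′ ∸ g) (splitCnt M₁ k g′ u) v) others
               (trans (sym (cnt≡∑splitCnt M u v)) (trans (same (u ++ v)) (cnt≡∑splitCnt M₁ u v))) ⟩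
        withLoops (g ∸ g) (splitCnt M₁ k g u) v   ≡⟨ cong (λ j → withLoops j (splitCnt M₁ k g u) v) (n∸n≡0 g) ⟩
        withLoops 0 (splitCnt M₁ k g u) v         ≡⟨ withLoops-0 (splitCnt M₁ k g u) v ⟩
        splitCnt M₁ k g u v                       ∎
        where
        open ≡-Reasoning
        -- Larger sizes agree by induction. For smaller sizes `u` is longer than the flat, and both
        -- counts are 0.
        others : ∀ g′ → g′ ≢ g → withLoops (g′ ∸ g) (splitCnt M k g′ u) v ≡ withLoops (g′ ∸ g) (splitCnt M₁ k g′ u) v
        others g′ g′≢g = withLoops-cong (g′ ∸ g) (λ v → case ≤-<-connex g g′ of λ where
          (inj₁ g≤g′) → bigger g′ (≤∧≢⇒< g≤g′ (g′≢g ∘ sym)) u v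
          (inj₂ g′<g) → trans (proj₂ (splitCnt-extensive M k g′ v) u g′<g)
                              (sym (proj₂ (splitCnt-extensive M₁ k g′ v) u g′<g))) v

-- Orderings and the 𝒢-invariant

-- Follows the recursion of `cnt`, but as a condition on a single sequence, which can be compared
-- with `IsOrdering`.
Path : (ρ : Subset N → ℕ) (E S : Subset N) → ∀ {m} → Vec ℕ m → Vec (Fin N) m → Set
Path ρ E S []      []      = Unit
Path ρ E S (b ∷ w) (x ∷ π) = Step ρ E S b x × Path ρ E (S ∪ ⁅ x ⁆) w π

path? : (ρ : Subset N → ℕ) (E S : Subset N) → ∀ {m} (w : Vec ℕ m) → Decidable (Path ρ E S w)
path? ρ E S []      []      = yes tt
path? ρ E S (b ∷ w) (x ∷ π) = step? ρ E S b x ×-dec path? ρ E (S ∪ ⁅ x ⁆) w π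

∑-path : (ρ : Subset N → ℕ) (E S : Subset N) → ∀ {m} (w : Vec ℕ m) →
         ∑ (vectors (allFin N) m) (λ π → ⟦ path? ρ E S w π ⟧) ≡ cnt ρ E S (toList w)
∑-path ρ E S []      = refl
∑-path {N} ρ E S {suc m} (b ∷ w) = begin
  ∑ (vectors (allFin N) (suc m)) (λ π → ⟦ path? ρ E S (b ∷ w) π ⟧)
    ≡⟨ ∑-cartesianProductWith _∷_ (allFin N) (vectors (allFin N) m) _ ⟩
  ∑ (allFin N) (λ x → ∑ (vectors (allFin N) m) (λ π → ⟦ step? ρ E S b x ×-dec path? ρ E (S ∪ ⁅ x ⁆) w π ⟧))
    ≡⟨ ∑-cong (allFin N) (λ x → trans
         (∑-cong (vectors (allFin N) m) (λ π → ⟦⟧-×-dec (step? ρ E S b x) (path? ρ E (S ∪ ⁅ x ⁆) w π)))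
         (sym (*-∑ ⟦ step? ρ E S b x ⟧ (vectors (allFin N) m) _))) ⟩
  ∑∣ (step? ρ E S b) (allFin N) (λ x → ∑ (vectors (allFin N) m) (λ π → ⟦ path? ρ E (S ∪ ⁅ x ⁆) w π ⟧))
    ≡⟨ ∑∣-congʳ (step? ρ E S b) (allFin N) (λ x _ → ∑-path ρ E (S ∪ ⁅ x ⁆) w) ⟩
  cnt ρ E S (b ∷ toList w) ∎
  where open ≡-Reasoning

module _ {N n r : ℕ} (M : Matroid N n r) where

  private
    E = ground M
    ρ = rank M

  ordering⇒path : {S : Subset N} → ∀ {m} (π : Vec (Fin N) m) →
    (∀ i → lookup π i ∈ E) → (∀ i → lookup π i ∉ S) → (∀ i j → lookup π i ≡ lookup π j → i ≡ j) →
    Path ρ E S (rankIncrements M S π) π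
  ordering⇒path []      π∈E π∉S inj = tt
  ordering⇒path {S} (x ∷ π) π∈E π∉S inj =
    (π∈E zero , π∉S zero , refl) ,
    ordering⇒path π (π∈E ∘ suc)
      (λ i → [ π∉S (suc i) , (λ π∈ → case inj (suc i) zero (x∈⁅y⁆⇒x≡y x π∈) of λ ()) ]′ ∘ x∈p∪q⁻ S ⁅ x ⁆)
      (λ i j eq → Fin.suc-injective (inj (suc i) (suc j) eq))

  path⇒increments : {S : Subset N} → ∀ {m} {w : Vec ℕ m} (π : Vec (Fin N) m) →
                    Path ρ E S w π → rankIncrements M S π ≡ w
  path⇒increments {w = []}    []      _ = refl
  path⇒increments {w = b ∷ w} (x ∷ π) ((_ , _ , inc≡b) , path) = cong₂ _∷_ inc≡b (path⇒increments π path)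

  path⇒∈ : {S : Subset N} → ∀ {m} {w : Vec ℕ m} (π : Vec (Fin N) m) →
           Path ρ E S w π → ∀ i → lookup π i ∈ E
  path⇒∈ {w = b ∷ w} (x ∷ π) ((x∈E , _) , path) zero    = x∈E
  path⇒∈ {w = b ∷ w} (x ∷ π) (_ , path)         (suc i) = path⇒∈ π path i

  path⇒∉ : {S : Subset N} → ∀ {m} {w : Vec ℕ m} (π : Vec (Fin N) m) →
           Path ρ E S w π → ∀ i → lookup π i ∉ S
  path⇒∉ {w = b ∷ w} (x ∷ π) ((_ , x∉S , _) , path) zero    = x∉S
  path⇒∉ {S} {w = b ∷ w} (x ∷ π) (_ , path)         (suc i) = path⇒∉ π path i ∘ X⊆X∪⁅x⁆ S x

  path⇒injective : {S : Subset N} → ∀ {m} {w : Vec ℕ m} (π : Vec (Fin N) m) →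
                   Path ρ E S w π → ∀ i j → lookup π i ≡ lookup π j → i ≡ j
  path⇒injective {w = b ∷ w} (x ∷ π) path zero zero eq = refl
  path⇒injective {S} {w = b ∷ w} (x ∷ π) (_ , path) zero (suc j) eq =
    ⊥-elim (path⇒∉ π path j (subst (_∈ S ∪ ⁅ x ⁆) eq (x∈X∪⁅x⁆ S x)))
  path⇒injective {S} {w = b ∷ w} (x ∷ π) (_ , path) (suc i) zero eq =
    ⊥-elim (path⇒∉ π path i (subst (_∈ S ∪ ⁅ x ⁆) (sym eq) (x∈X∪⁅x⁆ S x)))
  path⇒injective {w = b ∷ w} (x ∷ π) (_ , path) (suc i) (suc j) eq = cong suc (path⇒injective π path i j eq)

  -- The entries of a path are distinct and lie outside `S`; as many of them as `E` has elements
  -- outside `S` leave nothing uncovered.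
  path⇒covers : {S : Subset N} → S ⊆ E → ∀ {m} {w : Vec ℕ m} (π : Vec (Fin N) m) →
                Path ρ E S w π → ∣ E ∣ ≡ ∣ S ∣ + m → ∀ y → y ∈ E → y ∉ S → ∃ λ i → lookup π i ≡ y
  path⇒covers S⊆E {w = []} [] _ full y y∈E y∉S =
    ⊥-elim (y∉S (subst (y ∈_) (sym (⊆∧∣∣≤⇒≡ S⊆E (≤-reflexive (trans full (+-identityʳ _))))) y∈E))
  path⇒covers {S} S⊆E {suc m} {w = b ∷ w} (x ∷ π) ((x∈E , x∉S , _) , path) full y y∈E y∉S with y Fin.≟ x
  ... | yes refl = zero , refl
  ... | no  y≢x  = let i , eq = path⇒covers (∪⁅⁆⊆ S⊆E x∈E) π path
                        (trans full (trans (+-suc ∣ S ∣ m) (cong (_+ m) (sym (∣X∪⁅x⁆∣ x∉S))))) y y∈E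
                        ([ y∉S , y≢x ∘ x∈⁅y⁆⇒x≡y x ]′ ∘ x∈p∪q⁻ S ⁅ x ⁆)
                   in suc i , eq

  -- The coefficient of `w` in the invariant as a natural number, before it is mapped into the
  -- field; `w` ranges over all vectors, not only over symbols.
  coefficient : Vec ℕ n → ℕ
  coefficient w = ∑ (orderings M) (λ π → ⟦ Vec.≡-dec _≟_ (entries (rankSequence M π)) w ⟧)

  ∑-toList : {P : A → Set} {xs : List A} (pxs : ListAll.All P xs) (g : A → ℕ) →
             ∑ (ListAll.toList pxs) (g ∘ proj₁) ≡ ∑ xs g
  ∑-toList []         g = refl
  ∑-toList (px ∷ pxs) g = cong (g _ +_) (∑-toList pxs g)

  coefficient≡cnt : ∀ w → coefficient w ≡ cnt ρ E ⊥ (toList w)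
  coefficient≡cnt w = begin
    coefficient w
      ≡⟨ ∑-toList (all-filter (isOrdering? M) (vectors (allFin N) n)) (λ π → ⟦ increments? π ⟧) ⟩
    ∑ (filter (isOrdering? M) (vectors (allFin N) n)) (λ π → ⟦ increments? π ⟧)
      ≡⟨ ∑-filter (isOrdering? M) (vectors (allFin N) n) _ ⟩
    ∑∣ (isOrdering? M) (vectors (allFin N) n) (λ π → ⟦ increments? π ⟧)
      ≡⟨ ∑-cong (vectors (allFin N) n) (λ π → trans
           (sym (⟦⟧-×-dec (isOrdering? M π) (increments? π)))
           (⟦⟧-cong (isOrdering? M π ×-dec increments? π) (path? ρ E ⊥ w π) (to π) (from π))) ⟩
    ∑ (vectors (allFin N) n) (λ π → ⟦ path? ρ E ⊥ w π ⟧)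
      ≡⟨ ∑-path ρ E ⊥ w ⟩
    cnt ρ E ⊥ (toList w) ∎
    where
    open ≡-Reasoning
    increments? : (π : Vec (Fin N) n) → Dec (rankIncrements M ⊥ π ≡ w)
    increments? π = Vec.≡-dec _≟_ (rankIncrements M ⊥ π) w
    to : ∀ π → IsOrdering M π × rankIncrements M ⊥ π ≡ w → Path ρ E ⊥ w π
    to π ((π∈E , inj , _) , refl) = ordering⇒path π π∈E (λ _ → ∉⊥) inj
    from : ∀ π → Path ρ E ⊥ w π → IsOrdering M π × rankIncrements M ⊥ π ≡ w
    from π path = (path⇒∈ π path , path⇒injective π path ,
        λ x x∈E → path⇒covers (⊆-min E) π path (trans (∣ground∣≡n M) (cong (_+ n) (sym (∣⊥∣≡0 N)))) x x∈E ∉⊥) ,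
      path⇒increments π path

∑≢0⇒∃ : {P : A → Set} (P? : Decidable P) (xs : List A) → ∑ xs (λ x → ⟦ P? x ⟧) ≢ 0 → ∃ P
∑≢0⇒∃ P? []       ≢0 = ⊥-elim (≢0 refl)
∑≢0⇒∃ P? (x ∷ xs) ≢0 with P? x
... | yes p = x , p
... | no ¬p = ∑≢0⇒∃ P? xs ≢0

-- Counts and coefficients in a field of characteristic zero

module _ {c ℓ₁ ℓ₂} (K : HeytingField c ℓ₁ ℓ₂) where

  private
    module R = CommutativeRing (HeytingCommutativeRing.commutativeRing (HeytingField.heytingCommutativeRing K))
  open R using (_≈_; 0#; 1#; +-cong; +-monoid; +-group) renaming (_+_ to _⊕_)
  open Mult +-monoid using (×-homo-+) renaming (_×_ to _·_)
  open GroupProperties +-group using (identityʳ-unique)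

  -- If two multiples of 1 agree, the multiple by their difference is 0, and characteristic zero
  -- forces the difference to vanish.
  ·1#-injective : CharacteristicZero K → ∀ a b → a · 1# ≈ b · 1# → a ≡ b
  ·1#-injective char0 a b a≈b =
    [ (λ a≤b → ordered a≤b a≈b) , (λ b≤a → sym (ordered b≤a (R.sym a≈b))) ]′ (≤-total a b)
    where
    vanish : ∀ d → d · 1# ≈ 0# → d ≡ 0
    vanish zero    _   = refl
    vanish (suc d) d≈0 = ⊥-elim (char0 d d≈0)
    ordered : ∀ {a b} → a ≤ b → a · 1# ≈ b · 1# → a ≡ b
    ordered {a} {b} a≤b a≈b = ≤-antisym a≤b (m∸n≡0⇒m≤n (vanish (b ∸ a)
      (identityʳ-unique (a · 1#) ((b ∸ a) · 1#) (R.trans (R.sym (×-homo-+ 1# a (b ∸ a)))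
        (R.trans (R.reflexive (cong (_· 1#) (m+[n∸m]≡n a≤b))) (R.sym a≈b))))))

  𝒢-invariant≈coefficient : (M : Matroid N n r) (t : Symbol n r) →
                            𝒢-invariant K M t ≈ coefficient M (entries t) · 1#
  𝒢-invariant≈coefficient M t = go (orderings M)
    where
    hits : ∃ (IsOrdering M) → ℕ
    hits π = ⟦ Vec.≡-dec _≟_ (entries (rankSequence M π)) (entries t) ⟧
    go : (πs : List (∃ (IsOrdering M))) →
         List.foldr (λ v w t → v t ⊕ w t) (λ _ → 0#) (map (λ π → basis K (rankSequence M π)) πs) t ≈
         ∑ πs hits · 1#
    go []       = R.refl
    go (π ∷ πs) with does (Vec.≡-dec _≟_ (entries (rankSequence M π)) (entries t))
    ... | true  = +-cong R.refl (go πs)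
    ... | false = R.trans (R.+-identityˡ _) (go πs)

  -- The coefficients give the counts for words of full length; extensivity carries the agreement to
  -- all partial orderings.
  Same𝒢⇒cnt : CharacteristicZero K → {N N₁ n r : ℕ} (M : Matroid N n r) (M₁ : Matroid N₁ n r) → Same𝒢 K M₁ M →
              ∀ w → cnt (rank M) (ground M) ⊥ w ≡ cnt (rank M₁) (ground M₁) ⊥ w
  Same𝒢⇒cnt char0 {n = n} {r} M M₁ same = extensive-≗ (extensive M) (extensive M₁) (full M M₁ same)
    where
    extensive : ∀ {N} (M : Matroid N n r) → Extensive n (cnt (rank M) (ground M) ⊥)
    extensive M = subst (λ n → Extensive n (cnt (rank M) (ground M) ⊥)) (∣ground∣≡n M) (cnt-extensive M id)

    full : ∀ {N N₁ n} (M : Matroid N n r) (M₁ : Matroid N₁ n r) → Same𝒢 K M₁ M → ∀ w → length w ≡ n →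
           cnt (rank M) (ground M) ⊥ w ≡ cnt (rank M₁) (ground M₁) ⊥ w
    full {N} {N₁} M M₁ same w refl = subst (λ w → cnt (rank M) (ground M) ⊥ w ≡ cnt (rank M₁) (ground M₁) ⊥ w)
      (Vec.toList∘fromList w)
      (trans (sym (coefficient≡cnt M v)) (trans coefficient≡ (coefficient≡cnt M₁ v)))
      where
      v : Vec ℕ (length w)
      v = fromList w
      at : (t : Symbol (length w) r) → coefficient M (entries t) ≡ coefficient M₁ (entries t)
      at t = ·1#-injective char0 _ _ (R.trans (R.sym (𝒢-invariant≈coefficient M t))
        (R.trans (R.sym (same t)) (𝒢-invariant≈coefficient M₁ t)))
      -- The invariants can be compared only at symbols. A vector with nonzero coefficient is the
      -- rank sequence of some ordering and hence a symbol; if both coefficients are 0 there is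
      -- nothing to compare.
      realised : ∀ {N} (M : Matroid N (length w) r) → coefficient M v ≢ 0 → ∃ λ (t : Symbol (length w) r) → entries t ≡ v
      realised M ≢0 = let π , eq = ∑≢0⇒∃ (λ π → Vec.≡-dec _≟_ (entries (rankSequence M π)) v) (orderings M) ≢0
                      in rankSequence M π , eq
      fromSymbol : (∃ λ (t : Symbol (length w) r) → entries t ≡ v) → coefficient M v ≡ coefficient M₁ v
      fromSymbol (t , eq) = subst (λ v → coefficient M v ≡ coefficient M₁ v) eq (at t)
      coefficient≡ : coefficient M v ≡ coefficient M₁ v
      coefficient≡ with coefficient M v ≟ 0 | coefficient M₁ v ≟ 0
      ... | yes ≡0 | yes ≡0₁ = trans ≡0 (sym ≡0₁)
      ... | no  ≢0 | _       = fromSymbol (realised M ≢0)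
      ... | yes _  | no ≢0   = fromSymbol (realised M₁ ≢0)

  cnt⇒Same𝒢 : {N N₁ n r : ℕ} (M : Matroid N n r) (M₁ : Matroid N₁ n r) →
              (∀ w → cnt (rank M) (ground M) ⊥ w ≡ cnt (rank M₁) (ground M₁) ⊥ w) → Same𝒢 K M₁ M
  cnt⇒Same𝒢 M M₁ same t = R.trans (𝒢-invariant≈coefficient M₁ t) (R.trans
    (R.reflexive (cong (_· 1#) (trans (coefficient≡cnt M₁ (entries t))
      (trans (sym (same (toList (entries t)))) (sym (coefficient≡cnt M (entries t)))))))
    (R.sym (𝒢-invariant≈coefficient M t)))

-- Chains of flats

∑∣-∑ : {P : A → Set} (P? : Decidable P) (xs : List A) (ys : List B) (g : A → B → ℕ) →
       ∑∣ P? xs (λ x → ∑ ys (g x)) ≡ ∑ ys (λ y → ∑∣ P? xs (λ x → g x y))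
∑∣-∑ P? xs ys g = trans (∑-cong xs (λ x → *-∑ ⟦ P? x ⟧ ys (g x))) (∑-swap xs ys _)

x∈p─q⇒x∉q : ∀ {N} (p q : Subset N) {x} → x ∈ p ─ q → x ∉ q
x∈p─q⇒x∉q (_ ∷ p) (inside ∷ q) () here
x∈p─q⇒x∉q (_ ∷ p) (_ ∷ q) (there x∈) (there x∈q) = x∈p─q⇒x∉q p q x∈ x∈q

∣q─p∣≡∣q∣∸∣p∣ : {p q : Subset N} → p ⊆ q → ∣ q ─ p ∣ ≡ ∣ q ∣ ∸ ∣ p ∣
∣q─p∣≡∣q∣∸∣p∣ {N} {p} {q} p⊆q = begin
  ∣ q ─ p ∣                                 ≡⟨ ∑-∈≡∣∣ (q ─ p) ⟨
  ∑∣ (_∈? (q ─ p)) (allFin N) (λ _ → 1)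
    ≡⟨ ∑∣-cong (_∈? (q ─ p)) (λ x → (x ∈? q) ×-dec ¬? (x ∈? p)) (allFin N)
         (λ x x∈ → p─q⊆p q p x∈ , x∈p─q⇒x∉q q p x∈) (λ x (x∈q , x∉p) → x∈p∧x∉q⇒x∈p─q x∈q x∉p) (λ _ _ _ → refl) ⟩
  ∑∣ (λ x → (x ∈? q) ×-dec ¬? (x ∈? p)) (allFin N) (λ _ → 1) ≡⟨ ∑-∖≡∣∣∸∣∣ p⊆q ⟩
  ∣ q ∣ ∸ ∣ p ∣                             ∎
  where open ≡-Reasoning

-- Entries are pairs of a rank and a size. Ranks may be skipped, so that flags, chains and all the
-- partly refined chains between them have the same form.
Levels : Set
Levels = List (ℕ × ℕ)

levels : ℕ → Vec ℕ m → Levels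
levels h []      = []
levels h (a ∷ s) = (h , a) ∷ levels (suc h) s

levels-∷ʳ : ∀ h (s : Vec ℕ m) a → levels h (s Vec.∷ʳ a) ≡ levels h s ∷ʳ (h + m , a)
levels-∷ʳ h []      a = cong (λ h → [ h , a ]) (sym (+-identityʳ h))
levels-∷ʳ {suc m} h (b ∷ s) a = cong ((h , b) ∷_)
  (trans (levels-∷ʳ (suc h) s a) (cong (λ i → levels (suc h) s ∷ʳ (i , a)) (sym (+-suc h m))))

module _ {N n r : ℕ} (M : Matroid N n r) where

  private
    E = ground M
    ρ = rank M

  -- The chains of flats above X whose successive ranks and sizes are the
  -- entries (j , t) of the list; equal consecutive flats are allowed.
  up : Subset N → Levels → ℕ
  up X []            = 1
  up X ((j , t) ∷ l) = ∑∣ (λ Y → isFlatOf? M j t Y ×-dec (X ⊆? Y)) (subsets N) (λ Y → up Y l)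

  above? : (X : Subset N) (j t : ℕ) → Decidable (λ Y → IsFlatOf M j t Y × X ⊆ Y)
  above? X j t Y = isFlatOf? M j t Y ×-dec (X ⊆? Y)

  covers? : (X : Subset N) (j : ℕ) → Decidable (λ Z → (IsFlat M Z × ρ Z ≡ suc j) × X ⊆ Z)
  covers? X j Z = (isFlat? M Z ×-dec (ρ Z ≟ suc j)) ×-dec (X ⊆? Z)

  -- The flats covering X partition the elements outside X.
  ∑-covers : ∀ {X Y} → IsFlat M X → IsFlat M Y → X ⊆ Y → ρ X < ρ Y →
    ∑∣ (λ Z → covers? X (ρ X) Z ×-dec (Z ⊆? Y)) (subsets N) (λ Z → ∣ Z ∣ ∸ ∣ X ∣) ≡ ∣ Y ∣ ∸ ∣ X ∣
  ∑-covers {X} {Y} flatX@(X⊆E , X-flat) flatY@(Y⊆E , _) X⊆Y ρX<ρY = begin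
    ∑∣ between? (subsets N) (λ Z → ∣ Z ∣ ∸ ∣ X ∣)
      ≡⟨ ∑∣-congʳ between? (subsets N) (λ Z ((_ , X⊆Z) , _) → ∑-∖≡∣∣∸∣∣ X⊆Z) ⟨
    ∑∣ between? (subsets N) (λ Z → ∑∣ (λ e → (e ∈? Z) ×-dec ¬? (e ∈? X)) (allFin N) (λ _ → 1))
      ≡⟨ ∑∣-swap between? (λ Z e → (e ∈? Z) ×-dec ¬? (e ∈? X)) new? (λ e Z → between? Z ×-dec (e ∈? Z))
           (subsets N) (allFin N)
           (λ Z e ((cov , Z⊆Y)) (e∈Z , e∉X) → (Z⊆Y e∈Z , e∉X) , ((cov , Z⊆Y) , e∈Z))
           (λ Z e (e∈Y , e∉X) (btw , e∈Z) → btw , (e∈Z , e∉X)) (λ _ _ _ _ _ _ → refl) ⟩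
    ∑∣ new? (allFin N) (λ e → ∑∣ (λ Z → between? Z ×-dec (e ∈? Z)) (subsets N) (λ _ → 1))
      ≡⟨ ∑∣-congʳ new? (allFin N) unique ⟩
    ∑∣ new? (allFin N) (λ _ → 1)
      ≡⟨ ∑-∖≡∣∣∸∣∣ X⊆Y ⟩
    ∣ Y ∣ ∸ ∣ X ∣ ∎
    where
    open ≡-Reasoning
    between? = λ Z → covers? X (ρ X) Z ×-dec (Z ⊆? Y)
    new?     = λ e → (e ∈? Y) ×-dec ¬? (e ∈? X)
    -- The only cover of `X` containing `e` is the closure `C` of `X ∪ ⁅ e ⁆`. Its rank is
    -- `suc (ρ X)` since `X` is a flat, and it lies below the flat `Y`.
    unique : ∀ e → e ∈ Y × e ∉ X → ∑∣ (λ Z → between? Z ×-dec (e ∈? Z)) (subsets N) (λ _ → 1) ≡ 1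
    unique e (e∈Y , e∉X) = ∑-subset-single (λ Z → between? Z ×-dec (e ∈? Z))
      ((((flatC , trans ρC≡ ρX′≡) , X′⊆C ∘ X⊆X∪⁅x⁆ X e) ,
        flat-⊇ M flatY (proj₁ flatC) X′⊆C (∪⁅⁆⊆ X⊆Y e∈Y) (≤-reflexive ρC≡)) , X′⊆C (x∈X∪⁅x⁆ X e))
      (λ { Z ((((flatZ , ρZ≡) , X⊆Z) , _) , e∈Z) →
        flat-unique M flatZ flatC (∪⁅⁆⊆ X⊆Z e∈Z) X′⊆C (trans ρZ≡ (sym ρX′≡)) ρC≡ })
      (λ _ → 1)
      where
      ρX′≡ : ρ (X ∪ ⁅ e ⁆) ≡ suc (ρ X)
      ρX′≡ = ≤-antisym (rank-∪⁅⁆≤ M X⊆E (Y⊆E e∈Y)) (X-flat e (Y⊆E e∈Y) e∉X)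
      cl = closure M (∪⁅⁆⊆ X⊆E (Y⊆E e∈Y))
      C = proj₁ cl
      flatC = proj₁ (proj₂ cl)
      ρC≡ = proj₁ (proj₂ (proj₂ cl))
      X′⊆C : X ∪ ⁅ e ⁆ ⊆ C
      X′⊆C = proj₂ (proj₂ (proj₂ cl))

  -- By `∑-covers`, the factor `b ∸ ∣ X ∣` is a weighted sum over the covers `Z` of `X` below the
  -- next flat `Y`; exchanging `Y` and `Z` inserts `Z` into the chain.
  up-covers : ∀ {X} → IsFlat M X → ∀ {i} → ρ X < i → ∀ b q →
    (b ∸ ∣ X ∣) * up X ((i , b) ∷ q) ≡
    ∑∣ (covers? X (ρ X)) (subsets N) (λ Z → (∣ Z ∣ ∸ ∣ X ∣) * up Z ((i , b) ∷ q))
  up-covers {X} flatX {i} ρX<i b q = begin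
    (b ∸ ∣ X ∣) * up X ((i , b) ∷ q)
      ≡⟨ *-∑∣ (b ∸ ∣ X ∣) (above? X i b) (subsets N) _ ⟩
    ∑∣ (above? X i b) (subsets N) (λ Y → (b ∸ ∣ X ∣) * up Y q)
      ≡⟨ ∑∣-congʳ (above? X i b) (subsets N) (λ { Y ((flatY , refl , refl) , X⊆Y) →
           trans (sym (∑∣-* (up Y q) (λ Z → covers? X (ρ X) Z ×-dec (Z ⊆? Y)) (subsets N) (λ Z → ∣ Z ∣ ∸ ∣ X ∣)))
             (cong (_* up Y q) (∑-covers flatX flatY X⊆Y ρX<i)) }) ⟨
    ∑∣ (above? X i b) (subsets N) (λ Y → ∑∣ (λ Z → covers? X (ρ X) Z ×-dec (Z ⊆? Y)) (subsets N)
      (λ Z → (∣ Z ∣ ∸ ∣ X ∣) * up Y q))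
      ≡⟨ ∑∣-swap (above? X i b) (λ Y Z → covers? X (ρ X) Z ×-dec (Z ⊆? Y))
           (covers? X (ρ X)) (λ Z → above? Z i b) (subsets N) (subsets N)
           (λ Y Z (flatY , _) (cov , Z⊆Y) → cov , (flatY , Z⊆Y))
           (λ Y Z cov (flatY , Z⊆Y) → (flatY , Z⊆Y ∘ proj₂ cov) , (cov , Z⊆Y))
           (λ _ _ _ _ _ _ → refl) ⟩
    ∑∣ (covers? X (ρ X)) (subsets N) (λ Z → ∑∣ (above? Z i b) (subsets N) (λ Y → (∣ Z ∣ ∸ ∣ X ∣) * up Y q))
      ≡⟨ ∑∣-congʳ (covers? X (ρ X)) (subsets N) (λ Z _ → *-∑∣ (∣ Z ∣ ∸ ∣ X ∣) (above? Z i b) (subsets N) _) ⟨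
    ∑∣ (covers? X (ρ X)) (subsets N) (λ Z → (∣ Z ∣ ∸ ∣ X ∣) * up Z ((i , b) ∷ q)) ∎
    where open ≡-Reasoning

  -- This is `up-covers` at the flat of rank `j`, reached after the prefix `p`, with the covers
  -- grouped by their size `u`.
  up-insert : ∀ X p {j i} → j < i → ∀ a b q →
    (b ∸ a) * up X (p ++ (j , a) ∷ (i , b) ∷ q) ≡
    ∑ (upTo (suc n)) (λ u → (u ∸ a) * up X (p ++ (j , a) ∷ (suc j , u) ∷ (i , b) ∷ q))
  up-insert X [] {j} {i} j<i a b q = begin
    (b ∸ a) * up X ((j , a) ∷ (i , b) ∷ q)
      ≡⟨ *-∑∣ (b ∸ a) (above? X j a) (subsets N) _ ⟩
    ∑∣ (above? X j a) (subsets N) (λ Y → (b ∸ a) * up Y ((i , b) ∷ q))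
      ≡⟨ ∑∣-congʳ (above? X j a) (subsets N) (λ { Y ((flatY , refl , refl) , _) → begin
           (b ∸ a) * up Y ((i , b) ∷ q)  ≡⟨ up-covers flatY j<i b q ⟩
           ∑∣ (covers? Y j) (subsets N) (λ Z → (∣ Z ∣ ∸ a) * up Z ((i , b) ∷ q))
             ≡⟨ ∑∣-fibres (covers? Y j) ∣_∣ (suc n) (λ Z ((flatZ , _) , _) → s≤s (flat-size≤n M flatZ)) (subsets N) _ ⟩
           ∑ (upTo (suc n)) (λ u → ∑∣ (λ Z → covers? Y j Z ×-dec (∣ Z ∣ ≟ u)) (subsets N) (λ Z → (∣ Z ∣ ∸ a) * up Z ((i , b) ∷ q)))
             ≡⟨ ∑-cong (upTo (suc n)) (λ u → ∑∣-cong (λ Z → covers? Y j Z ×-dec (∣ Z ∣ ≟ u)) (above? Y (suc j) u) (subsets N)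
                  (λ Z (((flatZ , ρZ) , Y⊆Z) , ∣Z∣) → (flatZ , ρZ , ∣Z∣) , Y⊆Z)
                  (λ Z ((flatZ , ρZ , ∣Z∣) , Y⊆Z) → ((flatZ , ρZ) , Y⊆Z) , ∣Z∣)
                  (λ { Z (_ , refl) _ → refl })) ⟩
           ∑ (upTo (suc n)) (λ u → ∑∣ (above? Y (suc j) u) (subsets N) (λ Z → (u ∸ a) * up Z ((i , b) ∷ q)))
             ≡⟨ ∑-cong (upTo (suc n)) (λ u → *-∑∣ (u ∸ a) (above? Y (suc j) u) (subsets N) _) ⟨
           ∑ (upTo (suc n)) (λ u → (u ∸ a) * up Y ((suc j , u) ∷ (i , b) ∷ q)) ∎ }) ⟩
    ∑∣ (above? X j a) (subsets N) (λ Y → ∑ (upTo (suc n)) (λ u → (u ∸ a) * up Y ((suc j , u) ∷ (i , b) ∷ q)))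
      ≡⟨ ∑∣-∑ (above? X j a) (subsets N) (upTo (suc n)) _ ⟩
    ∑ (upTo (suc n)) (λ u → ∑∣ (above? X j a) (subsets N) (λ Y → (u ∸ a) * up Y ((suc j , u) ∷ (i , b) ∷ q)))
      ≡⟨ ∑-cong (upTo (suc n)) (λ u → *-∑∣ (u ∸ a) (above? X j a) (subsets N) _) ⟨
    ∑ (upTo (suc n)) (λ u → (u ∸ a) * up X ((j , a) ∷ (suc j , u) ∷ (i , b) ∷ q)) ∎
    where open ≡-Reasoning
  up-insert X ((k , t) ∷ p) {j} {i} j<i a b q = begin
    (b ∸ a) * up X ((k , t) ∷ p ++ (j , a) ∷ (i , b) ∷ q)
      ≡⟨ *-∑∣ (b ∸ a) (above? X k t) (subsets N) _ ⟩
    ∑∣ (above? X k t) (subsets N) (λ Y → (b ∸ a) * up Y (p ++ (j , a) ∷ (i , b) ∷ q))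
      ≡⟨ ∑∣-congʳ (above? X k t) (subsets N) (λ Y _ → up-insert Y p j<i a b q) ⟩
    ∑∣ (above? X k t) (subsets N) (λ Y → ∑ (upTo (suc n)) (λ u → (u ∸ a) * up Y (p ++ (j , a) ∷ (suc j , u) ∷ (i , b) ∷ q)))
      ≡⟨ ∑∣-∑ (above? X k t) (subsets N) (upTo (suc n)) _ ⟩
    ∑ (upTo (suc n)) (λ u → ∑∣ (above? X k t) (subsets N) (λ Y → (u ∸ a) * up Y (p ++ (j , a) ∷ (suc j , u) ∷ (i , b) ∷ q)))
      ≡⟨ ∑-cong (upTo (suc n)) (λ u → *-∑∣ (u ∸ a) (above? X k t) (subsets N) _) ⟨
    ∑ (upTo (suc n)) (λ u → (u ∸ a) * up X ((k , t) ∷ p ++ (j , a) ∷ (suc j , u) ∷ (i , b) ∷ q)) ∎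
    where open ≡-Reasoning

  -- A flat of larger rank above another is strictly larger. This settles the case in which the
  -- factor `b ∸ a` of `up-insert` is 0 and cannot be cancelled.
  up-shrinking : ∀ X p {j i} → j < i → ∀ {a b} → b ≤ a → ∀ q → up X (p ++ (j , a) ∷ (i , b) ∷ q) ≡ 0
  up-shrinking X [] {j} {i} j<i {a} {b} b≤a q = ∑∣-zero (above? X j a) (subsets N)
    λ { Y ((flatY , refl , refl) , _) → ∑∣-none (above? Y i b) (subsets N)
      λ { Z ((flatZ , refl , refl) , Y⊆Z) → <⇒≱ (flat-size< M flatY flatZ Y⊆Z j<i) b≤a } }
  up-shrinking X ((k , t) ∷ p) j<i b≤a q = ∑∣-zero (above? X k t) (subsets N)
    λ Y _ → up-shrinking Y p j<i b≤a q

  -- The ground set is the only flat of rank `r`. Appending it gives an open-ended chain the upper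
  -- end that `up-insert` requires.
  up-top : ∀ {X} → X ⊆ E → ∀ l → up X (l ∷ʳ (r , n)) ≡ up X l
  up-top {X} X⊆E [] = ∑-subset-single (above? X r n) ((ground-flat M , rank-ground M , ∣ground∣≡n M) , X⊆E)
    (λ Y ((flatY , ρY , _) , _) → flat-rank≡r M flatY ρY) (λ _ → 1)
  up-top {X} X⊆E ((j , t) ∷ l) = ∑∣-congʳ (above? X j t) (subsets N) (λ Y ((flatY , _) , _) → up-top (proj₁ flatY) l)

  -- The closure of the empty set is the only flat of rank 0 and lies below every flat. Its size is
  -- not prescribed by `l`, hence the sum over `t`.
  up-bottom : ∀ l → up ⊥ l ≡ ∑ (upTo (suc n)) (λ t → up ⊥ ((0 , t) ∷ l))
  up-bottom l = sym (begin
    ∑ (upTo (suc n)) (λ t → up ⊥ ((0 , t) ∷ l))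
      ≡⟨ ∑-cong (upTo (suc n)) (λ t → ∑∣-cong (above? ⊥ 0 t) (λ Z → loops? Z ×-dec (∣ Z ∣ ≟ t)) (subsets N)
           (λ Z ((flatZ , ρZ , ∣Z∣) , _) → (flatZ , ρZ) , ∣Z∣)
           (λ Z ((flatZ , ρZ) , ∣Z∣) → (flatZ , ρZ , ∣Z∣) , ⊆-min Z) (λ _ _ _ → refl)) ⟩
    ∑ (upTo (suc n)) (λ t → ∑∣ (λ Z → loops? Z ×-dec (∣ Z ∣ ≟ t)) (subsets N) (λ Z → up Z l))
      ≡⟨ ∑∣-fibres loops? ∣_∣ (suc n) (λ Z (flatZ , _) → s≤s (flat-size≤n M flatZ)) (subsets N) _ ⟨
    ∑∣ loops? (subsets N) (λ Z → up Z l)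
      ≡⟨ ∑-subset-single loops? (flatC , trans ρC (rank-⊥ M))
           (λ { Z (flatZ , ρZ) → flat-unique M flatZ flatC (⊆-min Z) (⊆-min C) (trans ρZ (sym (rank-⊥ M))) ρC }) _ ⟩
    up C l
      ≡⟨ below-all l ⟩
    up ⊥ l ∎)
    where
    open ≡-Reasoning
    loops? = λ Z → isFlat? M Z ×-dec (ρ Z ≟ 0)
    cl = closure M (⊆-min E)
    C = proj₁ cl
    flatC = proj₁ (proj₂ cl)
    ρC = proj₁ (proj₂ (proj₂ cl))
    below-all : ∀ l → up C l ≡ up ⊥ l
    below-all []            = refl
    below-all ((j , t) ∷ l) = ∑∣-cong (above? C j t) (above? ⊥ j t) (subsets N)
      (λ Y (flatY , _) → flatY , ⊆-min Y)
      (λ { Y (flatY , _) → flatY , flat-⊇ M (proj₁ flatY) (proj₁ flatC) (⊆-min C) (⊆-min Y) (≤-reflexive ρC) })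
      (λ _ _ _ → refl)

  ⊆∧rank<⇒⊂ : ∀ {X Y} → X ⊆ Y → ρ X < ρ Y → X ⊂ Y
  ⊆∧rank<⇒⊂ {X} {Y} X⊆Y ρX<ρY with X ⊂? Y
  ... | yes X⊂Y = X⊂Y
  ... | no ¬X⊂Y = ⊥-elim (<-irrefl (cong ρ (⊆-antisym X⊆Y Y⊆X)) ρX<ρY)
    where
    Y⊆X : Y ⊆ X
    Y⊆X {y} y∈Y with y ∈? X
    ... | yes y∈X = y∈X
    ... | no  y∉X = ⊥-elim (¬X⊂Y (X⊆Y , y , y∈Y , y∉X))

  -- The chain condition in the recursive shape of `up`. Plain inclusion is enough, since the ranks
  -- rise by one and make it strict.
  Tower : Subset N → ℕ → Vec ℕ m → Vec (Subset N) m → Set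
  Tower X h []      []       = Unit
  Tower X h (a ∷ s) (Y ∷ Ys) = (IsFlatOf M h a Y × X ⊆ Y) × Tower Y (suc h) s Ys

  tower? : ∀ X h (s : Vec ℕ m) → Decidable (Tower X h s)
  tower? X h []      []       = yes tt
  tower? X h (a ∷ s) (Y ∷ Ys) = above? X h a Y ×-dec tower? Y (suc h) s Ys

  ∑-tower : ∀ X h (s : Vec ℕ m) → ∑ (vectors (subsets N) m) (λ Ys → ⟦ tower? X h s Ys ⟧) ≡ up X (levels h s)
  ∑-tower X h []      = refl
  ∑-tower {suc m} X h (a ∷ s) = begin
    ∑ (vectors (subsets N) (suc m)) (λ Ys → ⟦ tower? X h (a ∷ s) Ys ⟧)
      ≡⟨ ∑-cartesianProductWith _∷_ (subsets N) (vectors (subsets N) m) _ ⟩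
    ∑ (subsets N) (λ Y → ∑ (vectors (subsets N) m) (λ Ys → ⟦ above? X h a Y ×-dec tower? Y (suc h) s Ys ⟧))
      ≡⟨ ∑-cong (subsets N) (λ Y → trans
           (∑-cong (vectors (subsets N) m) (λ Ys → ⟦⟧-×-dec (above? X h a Y) (tower? Y (suc h) s Ys)))
           (sym (*-∑ ⟦ above? X h a Y ⟧ (vectors (subsets N) m) _))) ⟩
    ∑∣ (above? X h a) (subsets N) (λ Y → ∑ (vectors (subsets N) m) (λ Ys → ⟦ tower? Y (suc h) s Ys ⟧))
      ≡⟨ ∑∣-congʳ (above? X h a) (subsets N) (λ Y _ → ∑-tower Y (suc h) s) ⟩
    up X (levels h (a ∷ s)) ∎
    where open ≡-Reasoning

  chain⇒tower : ∀ {X h} (s : Vec ℕ (suc m)) (Ys : Vec (Subset N) (suc m)) → X ⊆ lookup Ys zero →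
                IsChainOf M h s Ys → Tower X h s Ys
  chain⇒tower {h = h} (a ∷ []) (Y ∷ []) X⊆Y ((flats , _) , sizes) =
    ((proj₁ (flats zero) , trans (proj₂ (flats zero)) (+-identityʳ h) , Vec.∷-injectiveˡ sizes) , X⊆Y) , tt
  chain⇒tower {h = h} (a ∷ s@(_ ∷ _)) (Y ∷ Ys@(_ ∷ _)) X⊆Y ((flats , strict) , sizes) =
    ((proj₁ (flats zero) , trans (proj₂ (flats zero)) (+-identityʳ h) , Vec.∷-injectiveˡ sizes) , X⊆Y) ,
    chain⇒tower s Ys (p⊂q⇒p⊆q (strict zero))
      (((λ i → proj₁ (flats (suc i)) , trans (proj₂ (flats (suc i))) (+-suc h (toℕ i))) , strict ∘ suc) ,
       Vec.∷-injectiveʳ sizes)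

  tower⇒chain : ∀ {X h} (s : Vec ℕ (suc m)) (Ys : Vec (Subset N) (suc m)) →
                Tower X h s Ys → IsChainOf M h s Ys
  tower⇒chain {h = h} (a ∷ []) (Y ∷ []) (((flatY , ρY , ∣Y∣) , _) , _) =
    ((λ { zero → flatY , trans ρY (sym (+-identityʳ h)) }) , λ ()) , cong (_∷ []) ∣Y∣
  tower⇒chain {h = h} (a ∷ s@(_ ∷ _)) (Y ∷ Ys@(_ ∷ _)) (((flatY , ρY , ∣Y∣) , _) , rest@(((_ , ρZ , _) , Y⊆Z) , _))
    with tower⇒chain s Ys rest
  ... | (flats , strict) , sizes =
    ((λ { zero    → flatY , trans ρY (sym (+-identityʳ h))
        ; (suc i) → proj₁ (flats i) , trans (proj₂ (flats i)) (sym (+-suc h (toℕ i))) }) ,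
     (λ { zero    → ⊆∧rank<⇒⊂ Y⊆Z (≤-reflexive (trans (cong suc ρY) (sym ρZ)))
        ; (suc i) → strict i })) ,
    cong₂ _∷_ ∣Y∣ sizes

  -- `F M h k` is the instance with `m` equal to `k ∸ h`; a free length permits flags and single
  -- flats as well.
  chains : ∀ h (s : Vec ℕ (suc m)) → ℕ
  chains h s = length (filter (isChainOf? M h s) (vectors (subsets N) _))

  chains≡up : ∀ h (s : Vec ℕ (suc m)) → chains h s ≡ up ⊥ (levels h s)
  chains≡up {m} h s = trans (length-filter≡∑ (isChainOf? M h s) (vectors (subsets N) (suc m))) (trans
    (∑-cong (vectors (subsets N) (suc m)) (λ Ys → ⟦⟧-cong (isChainOf? M h s Ys) (tower? ⊥ h s Ys)
      (chain⇒tower s Ys (⊆-min _)) (tower⇒chain s Ys)))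
    (∑-tower ⊥ h s))

-- Sizes along a flag and its composition

Nested : Vec (Subset N) (suc m) → Set
Nested Xs = ∀ i → lookup Xs (inject₁ i) ⊂ lookup Xs (suc i)

-- On a nested chain, `gaps 0` turns the sizes into the composition, and `partialSums 0` turns the
-- composition back into the sizes.
gaps : ℕ → Vec ℕ m → Vec ℕ m
gaps a []      = []
gaps a (b ∷ s) = b ∸ a ∷ gaps b s

partialSums : ℕ → Vec ℕ m → Vec ℕ m
partialSums a []      = []
partialSums a (d ∷ s) = a + d ∷ partialSums (a + d) s

module _ {N : ℕ} where

  differences≡gaps : (X : Subset N) (Xs : Vec (Subset N) m) → Nested (X ∷ Xs) →
                     differences X Xs ≡ gaps ∣ X ∣ (Vec.map ∣_∣ Xs)
  differences≡gaps X []       nested = refl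
  differences≡gaps X (Y ∷ Ys) nested = cong₂ _∷_ (∣q─p∣≡∣q∣∸∣p∣ (p⊂q⇒p⊆q (nested zero))) (differences≡gaps Y Ys (nested ∘ suc))

  composition≡gaps : (Xs : Vec (Subset N) (suc m)) → Nested Xs → composition Xs ≡ gaps 0 (Vec.map ∣_∣ Xs)
  composition≡gaps (X ∷ Xs) nested = cong (∣ X ∣ ∷_) (differences≡gaps X Xs nested)

  ∣X∣+∣Y─X∣ : {X Y : Subset N} → X ⊂ Y → ∣ X ∣ + ∣ Y ─ X ∣ ≡ ∣ Y ∣
  ∣X∣+∣Y─X∣ {X} X⊂Y = trans (cong (∣ X ∣ +_) (∣q─p∣≡∣q∣∸∣p∣ (p⊂q⇒p⊆q X⊂Y))) (m+[n∸m]≡n (p⊆q⇒∣p∣≤∣q∣ (p⊂q⇒p⊆q X⊂Y)))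

  partialSums-differences : (X : Subset N) (Xs : Vec (Subset N) m) → Nested (X ∷ Xs) →
                            partialSums ∣ X ∣ (differences X Xs) ≡ Vec.map ∣_∣ Xs
  partialSums-differences X []       nested = refl
  partialSums-differences X (Y ∷ Ys) nested = cong₂ _∷_ eq
    (trans (cong (λ a → partialSums a (differences Y Ys)) eq) (partialSums-differences Y Ys (nested ∘ suc)))
    where eq = ∣X∣+∣Y─X∣ (nested zero)

  partialSums-composition : (Xs : Vec (Subset N) (suc m)) → Nested Xs → partialSums 0 (composition Xs) ≡ Vec.map ∣_∣ Xs
  partialSums-composition (X ∷ Xs) nested = cong (∣ X ∣ ∷_) (partialSums-differences X Xs nested)

  differences-positive : (X : Subset N) (Xs : Vec (Subset N) m) → Nested (X ∷ Xs) → VecAll.All (0 <_) (differences X Xs)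
  differences-positive X []       nested = []
  differences-positive X (Y ∷ Ys) nested =
    subst (0 <_) (sym (∣q─p∣≡∣q∣∸∣p∣ (p⊂q⇒p⊆q (nested zero)))) (m<n⇒0<n∸m (p⊂q⇒∣p∣<∣q∣ (nested zero))) ∷
    differences-positive Y Ys (nested ∘ suc)

  sum-composition : (Xs : Vec (Subset N) (suc m)) → Nested Xs → Vec.sum (composition Xs) ≡ ∣ lookup Xs (fromℕ m) ∣
  sum-composition (X ∷ [])     nested = +-identityʳ ∣ X ∣
  sum-composition (X ∷ Y ∷ Ys) nested = trans (sym (+-assoc ∣ X ∣ _ _))
    (trans (cong (_+ Vec.sum (differences Y Ys)) (∣X∣+∣Y─X∣ (nested zero))) (sum-composition (Y ∷ Ys) (nested ∘ suc)))

module _ {N n r : ℕ} (M : Matroid N n r) where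

  chain-top : (Xs : Vec (Subset N) (suc r)) → IsChain M 0 Xs → lookup Xs (fromℕ r) ≡ ground M
  chain-top Xs (flats , _) = flat-rank≡r M (proj₁ (flats (fromℕ r))) (trans (proj₂ (flats (fromℕ r))) (Fin.toℕ-fromℕ r))

  -- Positivity and total are read off an actual chain, so a composition is formed only for sizes
  -- that occur.
  flagComposition : {Xs : Vec (Subset N) (suc r)} → IsChain M 0 Xs → Composition n r
  flagComposition {Xs} chain = record
    { parts    = composition Xs
    ; positive = increasing Xs (proj₂ chain)
    ; total    = trans (sum-composition Xs (proj₂ chain)) (trans (cong ∣_∣ (chain-top Xs chain)) (∣ground∣≡n M))
    }
    where
    increasing : ∀ {m} (Xs : Vec (Subset N) (suc m)) → Nested Xs → VecAll.All (0 <_) (Vec.tail (composition Xs))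
    increasing (X ∷ Xs) nested = differences-positive X Xs nested

-- Composition and sizes determine each other, and a chain through the ranks 0 to `r` ends at the
-- ground set. The composition may come from a chain in a different matroid `M`, which allows
-- comparing the two.
ν≡chains : {N N₁ n r : ℕ} (M : Matroid N n r) (M₁ : Matroid N₁ n r) {Xs : Vec (Subset N) (suc r)}
           (chain : IsChain M 0 Xs) → ν M₁ (flagComposition M chain) ≡ chains M₁ 0 (Vec.map ∣_∣ Xs)
ν≡chains {N₁ = N₁} {r = r} M M₁ {Xs} chain = trans
  (length-filter≡∑ (isFlagOf? M₁ a) (vectors (subsets N₁) (suc r)))
  (trans (∑-cong (vectors (subsets N₁) (suc r)) (λ Ys → ⟦⟧-cong (isFlagOf? M₁ a Ys) (isChainOf? M₁ 0 (Vec.map ∣_∣ Xs) Ys)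
    (λ ((chainY , _) , same) → chainY ,
      trans (sym (partialSums-composition Ys (proj₂ chainY))) (trans (cong (partialSums 0) same) (partialSums-composition Xs (proj₂ chain))))
    (λ (chainY , same) → (chainY , chain-top M₁ Ys chainY) ,
      trans (composition≡gaps Ys (proj₂ chainY)) (trans (cong (gaps 0) same) (sym (composition≡gaps Xs (proj₂ chain)))))))
    (sym (length-filter≡∑ (isChainOf? M₁ 0 (Vec.map ∣_∣ Xs)) (vectors (subsets N₁) (suc r)))))
  where a = flagComposition M chain

realisedSizes : (M : Matroid N n r) (s : Vec ℕ (suc r)) → chains M 0 s ≢ 0 →
                ∃ λ Xs → IsChainOf M 0 s Xs
realisedSizes {N} {r = r} M s ≢0 = ∑≢0⇒∃ (isChainOf? M 0 s) (vectors (subsets N) (suc r))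
  (≢0 ∘ trans (length-filter≡∑ (isChainOf? M 0 s) (vectors (subsets N) (suc r))))

Ascending : ℕ → ℕ → Levels → Set
Ascending r j []            = Unit
Ascending r j ((i , b) ∷ q) = j < i × i ≤ r × Ascending r i q

levels-ascending : ∀ {r j h} (s : Vec ℕ m) → j < h → h + m ≤ suc r → Ascending r j (levels h s)
levels-ascending []                  j<h bound = tt
levels-ascending {suc m} {h = h} (a ∷ s) j<h bound =
  j<h , ≤-trans (m≤m+n h m) (≤-pred bound′) , levels-ascending s ≤-refl bound′
  where bound′ = ≤-trans (≤-reflexive (sym (+-suc h m))) bound

-- Chain counts determined by catenary data

module _ {N N₁ n r : ℕ} (M : Matroid N n r) (M₁ : Matroid N₁ n r) (same : SameCatenaryData M₁ M) where

  -- Sizes that occur in neither matroid give 0 twice; otherwise a chain in one of them supplies the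
  -- composition at which the catenary data are compared.
  flags-≗ : (s : Vec ℕ (suc r)) → chains M₁ 0 s ≡ chains M 0 s
  flags-≗ s with chains M₁ 0 s ≟ 0 | chains M 0 s ≟ 0
  ... | yes ≡0₁ | yes ≡0 = trans ≡0₁ (sym ≡0)
  ... | no ≢0   | _      with realisedSizes M₁ s ≢0
  ...   | Xs , chain , refl = trans (sym (ν≡chains M₁ M₁ chain)) (trans (same (flagComposition M₁ chain)) (ν≡chains M₁ M chain))
  flags-≗ s | yes _ | no ≢0 with realisedSizes M s ≢0
  ...   | Xs , chain , refl = trans (sym (ν≡chains M M₁ chain)) (trans (same (flagComposition M chain)) (ν≡chains M M chain))

  -- Refine the chain from the bottom until it is a flag.
  up-≗ : ∀ d {j} → j + d ≡ r → (s : Vec ℕ j) (a : ℕ) (q : Levels) → Ascending r j q →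
         up M₁ ⊥ (levels 0 s ++ (j , a) ∷ q) ≡ up M ⊥ (levels 0 s ++ (j , a) ∷ q)
  up-≗ zero {j} j≡r s a ((i , b) ∷ q) (j<i , i≤r , _) =
    ⊥-elim (<⇒≱ j<i (≤-trans i≤r (≤-reflexive (trans (sym j≡r) (+-identityʳ j)))))
  -- With `j` equal to `r` the list has no gap from rank 0 to rank `r`, so it counts flags.
  up-≗ zero {j} j≡r s a [] _ with trans (sym (+-identityʳ j)) j≡r
  ... | refl = subst (λ l → up M₁ ⊥ l ≡ up M ⊥ l) (levels-∷ʳ 0 s a)
    (trans (sym (chains≡up M₁ 0 (s Vec.∷ʳ a))) (trans (flags-≗ (s Vec.∷ʳ a)) (chains≡up M 0 (s Vec.∷ʳ a))))
  up-≗ (suc d) {j} j+d≡r s a q asc = refine q asc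
    where
    raised : suc j + d ≡ r
    raised = trans (sym (+-suc j d)) j+d≡r

    next : ∀ u q → Ascending r (suc j) q →
           up M₁ ⊥ (levels 0 s ++ (j , a) ∷ (suc j , u) ∷ q) ≡ up M ⊥ (levels 0 s ++ (j , a) ∷ (suc j , u) ∷ q)
    next u q asc = subst (λ l → up M₁ ⊥ l ≡ up M ⊥ l)
      (trans (cong (_++ (suc j , u) ∷ q) (levels-∷ʳ 0 s a)) (++-assoc (levels 0 s) [ j , a ] ((suc j , u) ∷ q)))
      (up-≗ d raised (s Vec.∷ʳ a) u q asc)

    refine-∷ : ∀ i b q → Ascending r j ((i , b) ∷ q) →
               up M₁ ⊥ (levels 0 s ++ (j , a) ∷ (i , b) ∷ q) ≡ up M ⊥ (levels 0 s ++ (j , a) ∷ (i , b) ∷ q)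
    -- Either rank `suc j` is already present, or the sizes do not increase and both counts are 0,
    -- or `b ∸ a` is positive and can be cancelled once a flat of rank `suc j` has been inserted.
    refine-∷ i b q (j<i , i≤r , asc) with suc j ≟ i | ≤-<-connex b a
    ... | yes refl  | _        = next b q asc
    ... | no  _     | inj₁ b≤a = trans (up-shrinking M₁ ⊥ (levels 0 s) j<i b≤a q) (sym (up-shrinking M ⊥ (levels 0 s) j<i b≤a q))
    ... | no  1+j≢i | inj₂ a<b with b ∸ a in gap
    ...   | zero  = ⊥-elim (<⇒≱ a<b (m∸n≡0⇒m≤n gap))
    ...   | suc c = *-cancelˡ-≡ _ _ (suc c) (subst (λ c → c * up M₁ ⊥ l ≡ c * up M ⊥ l) gap (begin
      (b ∸ a) * up M₁ ⊥ l ≡⟨ up-insert M₁ ⊥ (levels 0 s) j<i a b q ⟩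
      ∑ (upTo (suc n)) (λ u → (u ∸ a) * up M₁ ⊥ (levels 0 s ++ (j , a) ∷ (suc j , u) ∷ (i , b) ∷ q))
        ≡⟨ ∑-cong (upTo (suc n)) (λ u → cong ((u ∸ a) *_) (next u ((i , b) ∷ q) (≤∧≢⇒< j<i 1+j≢i , i≤r , asc))) ⟩
      ∑ (upTo (suc n)) (λ u → (u ∸ a) * up M ⊥ (levels 0 s ++ (j , a) ∷ (suc j , u) ∷ (i , b) ∷ q))
        ≡⟨ up-insert M ⊥ (levels 0 s) j<i a b q ⟨
      (b ∸ a) * up M ⊥ l ∎))
      where
      open ≡-Reasoning
      l = levels 0 s ++ (j , a) ∷ (i , b) ∷ q

    refine : ∀ q → Ascending r j q → up M₁ ⊥ (levels 0 s ++ (j , a) ∷ q) ≡ up M ⊥ (levels 0 s ++ (j , a) ∷ q)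
    refine ((i , b) ∷ q) asc = refine-∷ i b q asc
    -- With nothing above rank `j`, the ground set is appended as the upper end of the gap.
    refine []            _   = begin
      up M₁ ⊥ (levels 0 s ∷ʳ (j , a))           ≡⟨ up-top M₁ (⊆-min _) (levels 0 s ∷ʳ (j , a)) ⟨
      up M₁ ⊥ (levels 0 s ∷ʳ (j , a) ∷ʳ (r , n)) ≡⟨ cong (up M₁ ⊥) (++-assoc (levels 0 s) _ _) ⟩
      up M₁ ⊥ (levels 0 s ++ (j , a) ∷ [ r , n ]) ≡⟨ refine-∷ r n [] (j<r , ≤-refl , tt) ⟩
      up M ⊥ (levels 0 s ++ (j , a) ∷ [ r , n ])  ≡⟨ cong (up M ⊥) (++-assoc (levels 0 s) _ _) ⟨
      up M ⊥ (levels 0 s ∷ʳ (j , a) ∷ʳ (r , n))  ≡⟨ up-top M (⊆-min _) (levels 0 s ∷ʳ (j , a)) ⟩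
      up M ⊥ (levels 0 s ∷ʳ (j , a))            ∎
      where
      open ≡-Reasoning
      j<r : j < r
      j<r = ≤-trans (m≤m+n (suc j) d) (≤-reflexive raised)

  -- The refinement starts at rank 0. A chain that starts higher is first extended by the closure of
  -- the empty set, of each possible size `t`.
  chains-≗ : ∀ h (s : Vec ℕ (suc m)) → h + m ≤ r → chains M₁ h s ≡ chains M h s
  chains-≗ {m} zero (a ∷ s) m≤r = trans (chains≡up M₁ 0 (a ∷ s)) (trans
    (up-≗ r refl [] a (levels 1 s) (levels-ascending s ≤-refl (s≤s m≤r)))
    (sym (chains≡up M 0 (a ∷ s))))
  chains-≗ {m} (suc h) s h+m≤r = begin
    chains M₁ (suc h) s                             ≡⟨ trans (chains≡up M₁ (suc h) s) (up-bottom M₁ (levels (suc h) s)) ⟩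
    ∑ (upTo (suc n)) (λ t → up M₁ ⊥ ((0 , t) ∷ levels (suc h) s))
      ≡⟨ ∑-cong (upTo (suc n)) (λ t → up-≗ r refl [] t (levels (suc h) s)
           (levels-ascending s (s≤s z≤n) (≤-trans (≤-reflexive (+-suc (suc h) m)) (s≤s h+m≤r)))) ⟩
    ∑ (upTo (suc n)) (λ t → up M ⊥ ((0 , t) ∷ levels (suc h) s))
      ≡⟨ trans (chains≡up M (suc h) s) (up-bottom M (levels (suc h) s)) ⟨
    chains M (suc h) s                              ∎
    where open ≡-Reasoning

-- Single flats, restriction and contraction

f≡chains : (M : Matroid N n r) → ∀ k s → f M k s ≡ chains M k (s ∷ [])
f≡chains {N} M k s = trans (length-filter≡∑ (isFlatOf? M k s) (subsets N)) (trans
  (∑-cong (subsets N) (λ Y → trans (⟦⟧-cong (isFlatOf? M k s Y) (above? M ⊥ k s Y) (λ flat → flat , ⊆-min Y) proj₁) (sym (*-identityʳ _))))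
  (sym (chains≡up M k (s ∷ []))))

flats-unique : (M : Matroid N n r) → ∀ {k s} → f M k s ≡ 1 → (A B : FlatOf M k s) → proj₁ B ≡ proj₁ A
flats-unique {N} M {k} {s} f≡1 (A , A-flat) (B , B-flat) =
  singleton f≡1 (∈-filter⁺ (isFlatOf? M k s) (∈-subsets B) B-flat) (∈-filter⁺ (isFlatOf? M k s) (∈-subsets A) A-flat)
  where
  singleton : {xs : List (Subset N)} → length xs ≡ 1 → ∀ {x y} → x ∈ˡ xs → y ∈ˡ xs → x ≡ y
  singleton {_ ∷ []} _ (here refl) (here refl) = refl

splitCnt-unique : (M : Matroid N n r) → ∀ {k s} → f M k s ≡ 1 → (A : FlatOf M k s) → ∀ u v →
  splitCnt M k s u v ≡ cnt (rank M) (proj₁ A) ⊥ u * cnt (rank M) (ground M) (proj₁ A) v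
splitCnt-unique M {k} {s} f≡1 A u v = ∑-subset-single (isFlatOf? M k s) (proj₂ A)
  (λ B B-flat → flats-unique M f≡1 A (B , B-flat)) _

-- The rank increment over `S` in the contraction is the increment over `S ∪ F` in `M`, because
-- `ρ F` cancels; starting from the empty set thus means starting from `F`.
cnt-contract : (M : Matroid N n r) → ∀ {k s} (A : FlatOf M k s) → ∀ w →
  cnt (rank (contract M A)) (ground (contract M A)) ⊥ w ≡ cnt (rank M) (ground M) (proj₁ A) w
cnt-contract {N} M A@(F , (F⊆E , _) , _) w = trans (shift (⊆-min _) w) (cong (λ S → cnt ρ E S w) (∪-identityˡ F))
  where
  E = ground M
  ρ = rank M
  ρ′ = rank (contract M A)

  shift : {S : Subset N} → S ⊆ E ─ F → ∀ w → cnt ρ′ (E ─ F) S w ≡ cnt ρ E (S ∪ F) w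
  shift S⊆ [] = refl
  shift {S} S⊆ (b ∷ w) = ∑∣-cong (step? ρ′ (E ─ F) S b) (step? ρ E (S ∪ F) b) (allFin N)
    (λ x (x∈ , x∉S , eq) → p─q⊆p E F x∈ , [ x∉S , x∈p─q⇒x∉q E F x∈ ]′ ∘ x∈p∪q⁻ S F , trans (sym (increment x)) eq)
    (λ x (x∈E , x∉S∪F , eq) → x∈p∧x∉q⇒x∈p─q x∈E (x∉S∪F ∘ q⊆p∪q S F) , x∉S∪F ∘ p⊆p∪q F , trans (increment x) eq)
    (λ x (x∈ , _) _ → trans (shift (∪⁅⁆⊆ S⊆ x∈) w) (cong (λ S → cnt ρ E S w) (exchange x)))
    where
    open ≡-Reasoning
    exchange : ∀ x → (S ∪ ⁅ x ⁆) ∪ F ≡ (S ∪ F) ∪ ⁅ x ⁆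
    exchange x = trans (∪-assoc S ⁅ x ⁆ F) (trans (cong (S ∪_) (∪-comm ⁅ x ⁆ F)) (sym (∪-assoc S F ⁅ x ⁆)))
    increment : ∀ x → ρ′ (S ∪ ⁅ x ⁆) ∸ ρ′ S ≡ ρ ((S ∪ F) ∪ ⁅ x ⁆) ∸ ρ (S ∪ F)
    increment x = begin
      (ρ ((S ∪ ⁅ x ⁆) ∪ F) ∸ ρ F) ∸ (ρ (S ∪ F) ∸ ρ F) ≡⟨ ∸-+-assoc (ρ ((S ∪ ⁅ x ⁆) ∪ F)) (ρ F) _ ⟩
      ρ ((S ∪ ⁅ x ⁆) ∪ F) ∸ (ρ F + (ρ (S ∪ F) ∸ ρ F))
        ≡⟨ cong₂ _∸_ (cong ρ (exchange x)) (m+[n∸m]≡n (rank-mono M (q⊆p∪q S F) (∪-least (p─q⊆p E F ∘ S⊆) F⊆E))) ⟩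
      ρ ((S ∪ F) ∪ ⁅ x ⁆) ∸ ρ (S ∪ F) ∎

proposition5p2 : ∀ {c ℓ₁ ℓ₂} {N N₁ n r : ℕ} (M : Matroid N n r) (M₁ : Matroid N₁ n r) →
    (SameCatenaryData M₁ M →
    (∀ h k → h ≤ k → k ≤ r → (s : Vec ℕ (suc (k ∸ h))) → F M₁ h k s ≡ F M h k s) ×
    (∀ k → k ≤ r → ∀ s → f M₁ k s ≡ f M k s)) ×
    ((K : HeytingField c ℓ₁ ℓ₂) → CharacteristicZero K →
    ∀ k s → k ≤ r → f M k s ≡ 1 → (A : FlatOf M k s) →
    Same𝒢 K M₁ M →
    f M₁ k s ≡ 1 ×
    Σ (FlatOf M₁ k s) (λ A₁ →
    (∀ (B : FlatOf M₁ k s) → proj₁ B ≡ proj₁ A₁) ×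
    Same𝒢 K (restrict M₁ A₁) (restrict M A) ×
    Same𝒢 K (contract M₁ A₁) (contract M A)))
proposition5p2 {n = n} M M₁ = fromCatenaryData , from𝒢
  where
  fromCatenaryData : SameCatenaryData M₁ M →
    (∀ h k → h ≤ k → k ≤ _ → (s : Vec ℕ (suc (k ∸ h))) → F M₁ h k s ≡ F M h k s) ×
    (∀ k → k ≤ _ → ∀ s → f M₁ k s ≡ f M k s)
  fromCatenaryData same =
    (λ h k h≤k k≤r s → chains-≗ M M₁ same h s (≤-trans (≤-reflexive (m+[n∸m]≡n h≤k)) k≤r)) ,
    (λ k k≤r s → trans (f≡chains M₁ k s) (trans
      (chains-≗ M M₁ same k (s ∷ []) (≤-trans (≤-reflexive (+-identityʳ k)) k≤r)) (sym (f≡chains M k s))))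

  from𝒢 : (K : HeytingField _ _ _) → CharacteristicZero K →
    ∀ k s → k ≤ _ → f M k s ≡ 1 → (A : FlatOf M k s) → Same𝒢 K M₁ M →
    f M₁ k s ≡ 1 ×
    Σ (FlatOf M₁ k s) (λ A₁ →
      (∀ (B : FlatOf M₁ k s) → proj₁ B ≡ proj₁ A₁) ×
      Same𝒢 K (restrict M₁ A₁) (restrict M A) ×
      Same𝒢 K (contract M₁ A₁) (contract M A))
  from𝒢 K char0 k s _ f≡1 A same = f₁≡1 , A₁ , flats-unique M₁ f₁≡1 A₁ ,
    -- A restriction keeps the rank function and only replaces the ground set, so `restricted` is by
    -- definition about its counts.
    cnt⇒Same𝒢 K (restrict M A) (restrict M₁ A₁) restricted ,
    cnt⇒Same𝒢 K (contract M A) (contract M₁ A₁) contracted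
    where
    open ≡-Reasoning
    E = ground M
    ρ = rank M
    E₁ = ground M₁
    ρ₁ = rank M₁
    splits : ∀ u v → splitCnt M k s u v ≡ splitCnt M₁ k s u v
    splits = splitCnt-≗ M M₁ (Same𝒢⇒cnt K char0 M M₁ same) k s
    f₁≡1 : f M₁ k s ≡ 1
    f₁≡1 = trans (sym (splitCnt-[] M₁ k s)) (trans (sym (splits [] [])) (trans (splitCnt-[] M k s) f≡1))
    A₁ : FlatOf M₁ k s
    A₁ = ∑≢0⇒∃ (isFlatOf? M₁ k s) (subsets _) λ ≡0 → case trans (sym f₁≡1)
      (trans (length-filter≡∑ (isFlatOf? M₁ k s) (subsets _)) ≡0) of λ ()
    products : ∀ u v → cnt ρ (proj₁ A) ⊥ u * cnt ρ E (proj₁ A) v ≡ cnt ρ₁ (proj₁ A₁) ⊥ u * cnt ρ₁ E₁ (proj₁ A₁) v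
    products u v = trans (sym (splitCnt-unique M f≡1 A u v)) (trans (splits u v) (splitCnt-unique M₁ f₁≡1 A₁ u v))
    -- The empty word has count 1: `v = []` in `products` isolates the restriction, and `u = []`
    -- below isolates the contraction.
    restricted : ∀ u → cnt ρ (proj₁ A) ⊥ u ≡ cnt ρ₁ (proj₁ A₁) ⊥ u
    restricted u = trans (sym (*-identityʳ _)) (trans (products u []) (*-identityʳ _))
    contracted : ∀ v → cnt (rank (contract M A)) (ground (contract M A)) ⊥ v ≡
                       cnt (rank (contract M₁ A₁)) (ground (contract M₁ A₁)) ⊥ v
    contracted v = begin
      cnt (rank (contract M A)) (ground (contract M A)) ⊥ v     ≡⟨ cnt-contract M A v ⟩
      cnt ρ E (proj₁ A) v                                       ≡⟨ *-identityˡ _ ⟨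
      1 * cnt ρ E (proj₁ A) v                                   ≡⟨ products [] v ⟩
      1 * cnt ρ₁ E₁ (proj₁ A₁) v                                ≡⟨ *-identityˡ _ ⟩
      cnt ρ₁ E₁ (proj₁ A₁) v                                    ≡⟨ cnt-contract M₁ A₁ v ⟨
      cnt (rank (contract M₁ A₁)) (ground (contract M₁ A₁)) ⊥ v ∎
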